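{- Any $\varepsilon$-node-differentially private algorithm to compute the weight of a minimum spanning tree in an incremental graph sequence of length $T$ must have additive error $\Omega(W\log T)$ when the edge weights are in $\{1,\dots,W\}$ and $W$ is a publicly known parameter. This holds even with $\varepsilon=1$.
   Context: Graphs are undirected and edge-weighted. An incremental graph sequence $(G_1,\dots,G_T)$ arises from an initial (possibly non-empty) graph $G_0$ by inserting at each time $t$ a set $\partial V_t^+$ of nodes and a set $\partial E_t^+$ of edges (no deletions). Two incremental sequences are node-adjacent (event-level) if they have the same length and initial graph, and (up to exchanging them) there are a node $v^*$ and a time $t^*$ with $\partial V_t^+=\partial V_t'^+$ for $t\ne t^*$, $\partial V_{t^*}'^+\subseteq\partial V_{t^*}^+$ and $\partial V_{t^*}^+\setminus\partial V_{t^*}'^+=\{v^*\}$; moreover every edge in $\partial E_t^+$ is incident to at least one node of $\partial V_t^+$, and $\partial E_t'^+$ is the maximal subset of $\partial E_t^+$ containing no edge incident to $v^*$. The algorithm is randomized and outputs a real number after each time step, an estimate of the value for the current graph. It is $\varepsilon$-node-differentially private if $\Pr[\mathcal A(\mathcal G)\in S]\le e^\varepsilon\Pr[\mathcal A(\mathcal G')\in S]$ for all node-adjacent $\mathcal G,\mathcal G'$ and all sets $S$ of possible output sequences. The additive error at a time step is the absolute difference between the output and the true value. For disconnected graphs, the weight of a minimum spanning tree means that of a minimum spanning forest. -}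

module Defs where

open import Data.Fin.Base as Fin using (Fin; zero; suc)
open import Data.Integer.Base as ℤ using (ℤ; +_; -[1+_]; +≤+)
import Data.Integer.Properties as ℤₚ
open import Data.List.Base using (List; _∷_; _++_; _∷ʳ_; length; map; sum)
open import Data.List.Membership.Propositional using (_∈_; _∉_)
open import Data.List.Relation.Binary.BagAndSetEquality using (_∼[_]_; set)
open import Data.List.Relation.Binary.Subset.Propositional using (_⊆_)
open import Data.List.Relation.Unary.Linked using (Linked)
open import Data.List.Relation.Unary.Unique.Propositional using (Unique)
open import Data.Nat.Base as ℕ using (ℕ; zero; suc; s≤s)
import Data.Nat.Properties as ℕₚ
open import Data.Product.Base using (∃; ∃-syntax; _×_; _,_; proj₁; proj₂)
open import Data.Rational.Base as ℚ using (ℚ; mkℚ; 0ℚ; 1ℚ; ½; _/_) hiding (module ℚ)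
open import Data.Rational.Literals using (fromℤ)
import Data.Rational.Properties as ℚₚ
open import Data.Rational.Solver using (module +-*-Solver)
import Data.Rational.Unnormalised.Base as ℚᵘ
import Data.Rational.Unnormalised.Properties as ℚᵘₚ
open import Data.Sum.Base using (_⊎_; inj₁; inj₂)
open import Function.Base using (_∘_)
open import Function.Bundles using (_⇔_)
open import Level using (0ℓ)
open import Relation.Binary.Construct.Closure.ReflexiveTransitive using (Star)
open import Relation.Binary.PropositionalEquality
  using (_≡_; _≢_; refl; sym; trans; cong; subst)
open import Relation.Nullary.Negation.Core using (¬_)
open import Relation.Unary using (Pred; U; ∁; ⋃; _≐_)

ι : ℕ → ℚ
ι n = fromℤ (+ n)

module RationalLemmas where
  open ℚ
  open ℚₚ.≤-Reasoning

  ∣p-p∣≡0 : ∀ p → ∣ p - p ∣ ≡ 0ℚ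
  ∣p-p∣≡0 p = cong ∣_∣ (ℚₚ.+-inverseʳ p)

  ∣p-q∣≡∣q-p∣ : ∀ p q → ∣ p - q ∣ ≡ ∣ q - p ∣
  ∣p-q∣≡∣q-p∣ p q = trans (sym (ℚₚ.∣-p∣≡∣p∣ (p - q))) (cong ∣_∣ (neg-sub p q))
    where
    neg-sub : ∀ p q → - (p - q) ≡ q - p
    neg-sub = solve 2 (λ p q → :- (p :- q) := q :- p) refl
      where open +-*-Solver

  p≤∣p∣ : ∀ p → p ≤ ∣ p ∣
  p≤∣p∣ p with ℚₚ.≤-total 0ℚ p
  ... | inj₁ 0≤p = ℚₚ.≤-reflexive (sym (ℚₚ.0≤p⇒∣p∣≡p 0≤p))
  ... | inj₂ p≤0 = ℚₚ.≤-trans p≤0 (ℚₚ.0≤∣p∣ p)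

  split : ∀ p q r → p - r ≡ (p - q) + (q - r)
  split = solve 3 (λ p q r → p :- r := (p :- q) :+ (q :- r)) refl
    where open +-*-Solver

  triangle : ∀ p q r → ∣ p - r ∣ ≤ ∣ p - q ∣ + ∣ q - r ∣
  triangle p q r = begin
    ∣ p - r ∣                ≡⟨ cong ∣_∣ (split p q r) ⟩
    ∣ (p - q) + (q - r) ∣    ≤⟨ ℚₚ.∣p+q∣≤∣p∣+∣q∣ (p - q) (q - r) ⟩
    ∣ p - q ∣ + ∣ q - r ∣    ∎

  p≤q+∣p-q∣ : ∀ p q → p ≤ q + ∣ p - q ∣
  p≤q+∣p-q∣ p q = begin
    p                  ≡⟨ solve 2 (λ p q → p := q :+ (p :- q)) refl p q ⟩
    q + (p - q)        ≤⟨ ℚₚ.+-monoʳ-≤ q (p≤∣p∣ (p - q)) ⟩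
    q + ∣ p - q ∣      ∎
    where open +-*-Solver

  p-q≤r : ∀ {p q r} → p ≤ q + r → p - q ≤ r
  p-q≤r {p} {q} {r} h = begin
    p - q          ≤⟨ ℚₚ.+-monoˡ-≤ (- q) h ⟩
    q + r - q      ≡⟨ solve 2 (λ q r → q :+ r :- q := r) refl q r ⟩
    r              ∎
    where open +-*-Solver

  ∣p∣≤r : ∀ {p r} → p ≤ r → - p ≤ r → ∣ p ∣ ≤ r
  ∣p∣≤r {p} h h' with ℚₚ.∣p∣≡p∨∣p∣≡-p p
  ... | inj₁ e = ℚₚ.≤-trans (ℚₚ.≤-reflexive e) h
  ... | inj₂ e = ℚₚ.≤-trans (ℚₚ.≤-reflexive e) h'

  ∣p∣≤∣q∣+∣p-q∣ : ∀ p q → ∣ p ∣ ≤ ∣ q ∣ + ∣ p - q ∣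
  ∣p∣≤∣q∣+∣p-q∣ p q = begin
    ∣ p ∣             ≡⟨ cong ∣_∣ (solve 2 (λ p q → p := q :+ (p :- q)) refl p q) ⟩
    ∣ q + (p - q) ∣   ≤⟨ ℚₚ.∣p+q∣≤∣p∣+∣q∣ q (p - q) ⟩
    ∣ q ∣ + ∣ p - q ∣ ∎
    where open +-*-Solver

  ∣∣p∣-∣q∣∣≤∣p-q∣ : ∀ p q → ∣ ∣ p ∣ - ∣ q ∣ ∣ ≤ ∣ p - q ∣
  ∣∣p∣-∣q∣∣≤∣p-q∣ p q = ∣p∣≤r (p-q≤r (∣p∣≤∣q∣+∣p-q∣ p q)) (begin
    - (∣ p ∣ - ∣ q ∣)  ≡⟨ solve 2 (λ p q → :- (p :- q) := q :- p) refl ∣ p ∣ ∣ q ∣ ⟩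
    ∣ q ∣ - ∣ p ∣      ≤⟨ p-q≤r (∣p∣≤∣q∣+∣p-q∣ q p) ⟩
    ∣ q - p ∣          ≡⟨ ∣p-q∣≡∣q-p∣ q p ⟩
    ∣ p - q ∣          ∎)
    where open +-*-Solver

  *-mono-≤ : ∀ {a b c d} → 0ℚ ≤ a → 0ℚ ≤ d → a ≤ b → c ≤ d → a * c ≤ b * d
  *-mono-≤ {a} {b} {c} {d} 0≤a 0≤d a≤b c≤d =
    ℚₚ.≤-trans (ℚₚ.*-monoˡ-≤-nonNeg a {{ℚ.nonNegative 0≤a}} c≤d)
               (ℚₚ.*-monoʳ-≤-nonNeg d {{ℚ.nonNegative 0≤d}} a≤b)

  0≤* : ∀ {a b} → 0ℚ ≤ a → 0ℚ ≤ b → 0ℚ ≤ a * b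
  0≤* {a} {b} 0≤a 0≤b = ℚₚ.≤-trans (ℚₚ.≤-reflexive (sym (ℚₚ.*-zeroˡ b)))
    (ℚₚ.*-monoʳ-≤-nonNeg b {{ℚ.nonNegative 0≤b}} 0≤a)

  0<* : ∀ {a b} → 0ℚ < a → 0ℚ < b → 0ℚ < a * b
  0<* {a} {b} 0<a 0<b = ℚₚ.≤-<-trans (ℚₚ.≤-reflexive (sym (ℚₚ.*-zeroˡ b)))
    (ℚₚ.*-monoˡ-<-pos b {{ℚ.positive 0<b}} 0<a)

  ∣*∣-mono-≤ : ∀ {a b c d} → ∣ a ∣ ≤ b → ∣ c ∣ ≤ d → ∣ a * c ∣ ≤ b * d
  ∣*∣-mono-≤ {a} {b} {c} {d} h h' = begin
    ∣ a * c ∣     ≡⟨ ℚₚ.∣p*q∣≡∣p∣*∣q∣ a c ⟩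
    ∣ a ∣ * ∣ c ∣ ≤⟨ *-mono-≤ (ℚₚ.0≤∣p∣ a) (ℚₚ.≤-trans (ℚₚ.0≤∣p∣ c) h') h h' ⟩
    b * d         ∎

  ½* : ℚ → ℚ
  ½* δ = ½ * δ

  ½+½ : ∀ δ → ½* δ + ½* δ ≡ δ
  ½+½ = solve 1 (λ δ → con ½ :* δ :+ con ½ :* δ := δ) refl
    where open +-*-Solver

  0<½* : ∀ {δ} → 0ℚ < δ → 0ℚ < ½* δ
  0<½* = 0<* (ℚₚ.positive⁻¹ ½)

  ι-suc : ∀ n → ι (suc n) ≡ 1ℚ + ι n
  ι-suc n = ℚₚ.toℚᵘ-injective (ℚᵘₚ.≃-trans
    (ℚᵘ.*≡* (trans (ℤₚ.*-identityʳ (+ suc n)) (sym (trans (ℤₚ.*-identityʳ _)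
      (cong (ℤ._+_ (+ 1)) (ℤₚ.*-identityʳ (+ n)))))))
    (ℚᵘₚ.≃-sym (ℚₚ.toℚᵘ-homo-+ 1ℚ (ι n))))

  1/suc : ∀ n → (+ 1 / suc n) * ι (suc n) ≡ 1ℚ
  1/suc n = ℚₚ.toℚᵘ-injective (ℚᵘₚ.≃-trans (ℚₚ.toℚᵘ-homo-* (+ 1 / suc n) (ι (suc n)))
    (ℚᵘₚ.≃-trans (ℚᵘₚ.*-congʳ {ℚ.toℚᵘ (ι (suc n))} (ℚₚ.toℚᵘ-fromℚᵘ (ℚᵘ.mkℚᵘ (+ 1) n)))
    (ℚᵘ.*≡* (ℤₚ.*-assoc (+ 1) (+ suc n) (+ 1)))))

  0<ι-suc : ∀ n → 0ℚ < ι (suc n)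
  0<ι-suc n = ℚₚ.positive⁻¹ (ι (suc n))

  0≤ι : ∀ n → 0ℚ ≤ ι n
  0≤ι n = ℚₚ.nonNegative⁻¹ (ι n)

  0≤1/suc : ∀ n → 0ℚ ≤ + 1 / suc n
  0≤1/suc n = ℚₚ.nonNegative⁻¹ _ {{ℚₚ.normalize-nonNeg 1 (suc n)}}

  ι-mono : ∀ {m n} → m ℕ.≤ n → ι m ≤ ι n
  ι-mono m≤n = *≤* (ℤₚ.*-monoʳ-≤-nonNeg (+ 1) (+≤+ m≤n))

  archimedean : ∀ q → ∃ λ n → q ≤ ι n
  archimedean (mkℚ n d c) = ℤ.∣ n ∣ , *≤* (ℤₚ.≤-trans
    (ℤₚ.≤-reflexive (ℤₚ.*-identityʳ n)) (ℤₚ.≤-trans (n≤∣n∣ n)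
    (ℤₚ.≤-trans (ℤₚ.≤-reflexive (sym (ℤₚ.*-identityʳ _)))
      (ℤₚ.*-monoˡ-≤-nonNeg (+ ℤ.∣ n ∣) (+≤+ (s≤s ℕ.z≤n))))))
    where
    n≤∣n∣ : ∀ n → n ℤ.≤ + ℤ.∣ n ∣
    n≤∣n∣ (+ n)    = ℤₚ.≤-refl
    n≤∣n∣ -[1+ n ] = ℤ.-≤+

  archimedean-* : ∀ q {δ} → 0ℚ < δ → ∃ λ n → q ≤ ι n * δ
  archimedean-* q {δ} 0<δ with archimedean (q * (1/ δ) {{>-nonZero 0<δ}})
  ... | n , h = n , (begin
    q                                      ≡⟨ sym (ℚₚ.*-identityʳ q) ⟩
    q * 1ℚ                                 ≡⟨ cong (q *_) (sym (ℚₚ.*-inverseˡ δ {{>-nonZero 0<δ}})) ⟩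
    q * ((1/ δ) {{>-nonZero 0<δ}} * δ)     ≡⟨ sym (ℚₚ.*-assoc q _ δ) ⟩
    q * (1/ δ) {{>-nonZero 0<δ}} * δ       ≤⟨ ℚₚ.*-monoʳ-≤-nonNeg δ {{ℚ.nonNegative (ℚₚ.<⇒≤ 0<δ)}} h ⟩
    ι n * δ                                ∎)

Cauchy : (ℕ → ℚ) → Set
Cauchy x = ∀ δ → 0ℚ ℚ.< δ → ∃ λ N → ∀ m n → N ℕ.≤ m → N ℕ.≤ n → ℚ.∣ x m ℚ.- x n ∣ ℚ.≤ δ

-- Two sequences represent the same real number when they are related by _≈ℝ_ below.
record ℝ : Set where
  constructor mkℝ
  field
    seq    : ℕ → ℚ
    cauchy : Cauchy seq

open ℝ public

module CauchyLemmas where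
  open ℚ
  open RationalLemmas
  open ℚₚ.≤-Reasoning

  abstract
    const-cauchy : ∀ q → Cauchy (λ _ → q)
    const-cauchy q δ 0<δ = 0 , λ _ _ _ _ →
      ℚₚ.≤-trans (ℚₚ.≤-reflexive (∣p-p∣≡0 q)) (ℚₚ.<⇒≤ 0<δ)

  abstract
    +-cauchy : ∀ {x y} → Cauchy x → Cauchy y → Cauchy (λ n → x n + y n)
    +-cauchy {x} {y} cx cy δ 0<δ with cx (½* δ) (0<½* 0<δ) | cy (½* δ) (0<½* 0<δ)
    ... | N , hx | M , hy = N ℕ.⊔ M , λ m n hm hn → begin
      ∣ (x m + y m) - (x n + y n) ∣      ≡⟨ cong ∣_∣ (regroup (x m) (y m) (x n) (y n)) ⟩
      ∣ (x m - x n) + (y m - y n) ∣      ≤⟨ ℚₚ.∣p+q∣≤∣p∣+∣q∣ (x m - x n) (y m - y n) ⟩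
      ∣ x m - x n ∣ + ∣ y m - y n ∣      ≤⟨ ℚₚ.+-mono-≤
           (hx m n (ℕₚ.m⊔n≤o⇒m≤o N M hm) (ℕₚ.m⊔n≤o⇒m≤o N M hn))
           (hy m n (ℕₚ.m⊔n≤o⇒n≤o N M hm) (ℕₚ.m⊔n≤o⇒n≤o N M hn)) ⟩
      ½* δ + ½* δ                        ≡⟨ ½+½ δ ⟩
      δ                                  ∎
      where
      regroup : ∀ a b c d → (a + b) - (c + d) ≡ (a - c) + (b - d)
      regroup = solve 4 (λ a b c d → (a :+ b) :- (c :+ d) := (a :- c) :+ (b :- d)) refl
        where open +-*-Solver

  abstract
    neg-cauchy : ∀ {x} → Cauchy x → Cauchy (λ n → - x n)
    neg-cauchy {x} cx δ 0<δ with cx δ 0<δ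
    ... | N , hx = N , λ m n hm hn → begin
      ∣ - x m - - x n ∣    ≡⟨ cong ∣_∣ (regroup (x m) (x n)) ⟩
      ∣ x n - x m ∣        ≤⟨ hx n m hn hm ⟩
      δ                    ∎
      where
      regroup : ∀ a b → - a - - b ≡ b - a
      regroup = solve 2 (λ a b → :- a :- :- b := b :- a) refl
        where open +-*-Solver

  abstract
    abs-cauchy : ∀ {x} → Cauchy x → Cauchy (λ n → ∣ x n ∣)
    abs-cauchy {x} cx δ 0<δ with cx δ 0<δ
    ... | N , hx = N , λ m n hm hn →
      ℚₚ.≤-trans (∣∣p∣-∣q∣∣≤∣p-q∣ (x m) (x n)) (hx m n hm hn)

  bounded : ∀ {x} → Cauchy x → ∃ λ B → ∃ λ N → ∀ n → N ℕ.≤ n → ∣ x n ∣ ≤ ι B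
  bounded {x} cx with cx 1ℚ (ℚₚ.positive⁻¹ 1ℚ)
  ... | N , hx with archimedean (∣ x N ∣ + 1ℚ)
  ...   | B , hB = B , N , λ n hn → begin
    ∣ x n ∣                    ≤⟨ ∣p∣≤∣q∣+∣p-q∣ (x n) (x N) ⟩
    ∣ x N ∣ + ∣ x n - x N ∣    ≤⟨ ℚₚ.+-monoʳ-≤ ∣ x N ∣ (hx n N hn ℕₚ.≤-refl) ⟩
    ∣ x N ∣ + 1ℚ               ≤⟨ hB ⟩
    ι B                        ∎

  shrink : ∀ D {δ} → 0ℚ ≤ D → 0ℚ < δ → ∃ λ σ → 0ℚ < σ × σ * D ≤ δ
  shrink D {δ} 0≤D 0<δ = δ * 1/D′ , 0<* 0<δ (ℚₚ.positive⁻¹ 1/D′ {{ℚₚ.1/pos⇒pos D′ {{D′-pos}}}}) , (begin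
    δ * 1/D′ * D     ≤⟨ ℚₚ.*-monoˡ-≤-nonNeg (δ * 1/D′) {{nonNeg′}} D≤D′ ⟩
    δ * 1/D′ * D′    ≡⟨ ℚₚ.*-assoc δ 1/D′ D′ ⟩
    δ * (1/D′ * D′)  ≡⟨ cong (δ *_) (ℚₚ.*-inverseˡ D′ {{D′≢0}}) ⟩
    δ * 1ℚ           ≡⟨ ℚₚ.*-identityʳ δ ⟩
    δ                ∎)
    where
    D′ : ℚ
    D′ = 1ℚ + D
    D≤D′ : D ≤ D′
    D≤D′ = ℚₚ.≤-trans (ℚₚ.≤-reflexive (sym (ℚₚ.+-identityˡ D)))
             (ℚₚ.+-monoˡ-≤ D (ℚₚ.<⇒≤ (ℚₚ.positive⁻¹ 1ℚ)))
    0<D′ : 0ℚ < D′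
    0<D′ = ℚₚ.<-≤-trans (ℚₚ.positive⁻¹ 1ℚ)
             (ℚₚ.≤-trans (ℚₚ.≤-reflexive (sym (ℚₚ.+-identityʳ 1ℚ))) (ℚₚ.+-monoʳ-≤ 1ℚ 0≤D))
    D′-pos : Positive D′
    D′-pos = ℚ.positive 0<D′
    D′≢0 : NonZero D′
    D′≢0 = >-nonZero 0<D′
    1/D′ : ℚ
    1/D′ = (1/ D′) {{D′≢0}}
    nonNeg′ : NonNegative (δ * 1/D′)
    nonNeg′ = ℚ.nonNegative (ℚₚ.<⇒≤ (0<* 0<δ (ℚₚ.positive⁻¹ 1/D′ {{ℚₚ.1/pos⇒pos D′ {{D′-pos}}}})))

  *-estimate : ∀ {x y a b c d σ τ} → ∣ a - c ∣ ≤ σ → ∣ b ∣ ≤ y → ∣ b - d ∣ ≤ τ → ∣ c ∣ ≤ x →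
               ∣ a * b - c * d ∣ ≤ σ * y + τ * x
  *-estimate {x} {y} {a} {b} {c} {d} {σ} {τ} hσ hy hτ hx = begin
    ∣ a * b - c * d ∣                    ≡⟨ cong ∣_∣ (regroup a b c d) ⟩
    ∣ (a - c) * b + (b - d) * c ∣        ≤⟨ ℚₚ.∣p+q∣≤∣p∣+∣q∣ ((a - c) * b) ((b - d) * c) ⟩
    ∣ (a - c) * b ∣ + ∣ (b - d) * c ∣    ≤⟨ ℚₚ.+-mono-≤ (∣*∣-mono-≤ {a - c} {σ} {b} {y} hσ hy) (∣*∣-mono-≤ {b - d} {τ} {c} {x} hτ hx) ⟩
    σ * y + τ * x                        ∎
    where
    regroup : ∀ a b c d → a * b - c * d ≡ (a - c) * b + (b - d) * c
    regroup = solve 4 (λ a b c d → a :* b :- c :* d := (a :- c) :* b :+ (b :- d) :* c) refl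
      where open +-*-Solver

  abstract
    *-cauchy : ∀ {x y} → Cauchy x → Cauchy y → Cauchy (λ n → x n * y n)
    *-cauchy {x} {y} cx cy δ 0<δ =
      let B , K , hB = bounded cx
          C , L , hC = bounded cy
          σ , 0<σ , hσ = shrink (ι C) (0≤ι C) (0<½* 0<δ)
          τ , 0<τ , hτ = shrink (ι B) (0≤ι B) (0<½* 0<δ)
          N , hx = cx σ 0<σ
          M , hy = cy τ 0<τ
      in combine B C K L N M σ τ hB hC hσ hτ hx hy
      where
      combine : ∀ B C K L N M σ τ →
        (∀ n → K ℕ.≤ n → ∣ x n ∣ ≤ ι B) → (∀ n → L ℕ.≤ n → ∣ y n ∣ ≤ ι C) →
        σ * ι C ≤ ½* δ → τ * ι B ≤ ½* δ →
        (∀ m n → N ℕ.≤ m → N ℕ.≤ n → ∣ x m - x n ∣ ≤ σ) →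
        (∀ m n → M ℕ.≤ m → M ℕ.≤ n → ∣ y m - y n ∣ ≤ τ) →
        ∃ λ J → ∀ m n → J ℕ.≤ m → J ℕ.≤ n → ∣ x m * y m - x n * y n ∣ ≤ δ
      combine B C K L N M σ τ hB hC hσ hτ hx hy = (K ℕ.⊔ L) ℕ.⊔ (N ℕ.⊔ M) , λ m n hm hn →
        let KL≤m = ℕₚ.m⊔n≤o⇒m≤o (K ℕ.⊔ L) (N ℕ.⊔ M) hm
            NM≤m = ℕₚ.m⊔n≤o⇒n≤o (K ℕ.⊔ L) (N ℕ.⊔ M) hm
            KL≤n = ℕₚ.m⊔n≤o⇒m≤o (K ℕ.⊔ L) (N ℕ.⊔ M) hn
            NM≤n = ℕₚ.m⊔n≤o⇒n≤o (K ℕ.⊔ L) (N ℕ.⊔ M) hn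
        in begin
        ∣ x m * y m - x n * y n ∣    ≤⟨ *-estimate {ι B} {ι C} {x m} {y m} {x n} {y n} {σ} {τ}
          (hx m n (ℕₚ.m⊔n≤o⇒m≤o N M NM≤m) (ℕₚ.m⊔n≤o⇒m≤o N M NM≤n))
          (hC m (ℕₚ.m⊔n≤o⇒n≤o K L KL≤m))
          (hy m n (ℕₚ.m⊔n≤o⇒n≤o N M NM≤m) (ℕₚ.m⊔n≤o⇒n≤o N M NM≤n))
          (hB n (ℕₚ.m⊔n≤o⇒m≤o K L KL≤n)) ⟩
        σ * ι C + τ * ι B            ≤⟨ ℚₚ.+-mono-≤ hσ hτ ⟩
        ½* δ + ½* δ                  ≡⟨ ½+½ δ ⟩
        δ                            ∎

-- `expTerm q k` is qᵏ / k!, and `expSum q n` is the sum of `expTerm q k` over k < n.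
expTerm : ℚ → ℕ → ℚ
expTerm q zero    = 1ℚ
expTerm q (suc k) = expTerm q k ℚ.* q ℚ.* (+ 1 / suc k)

expSum : ℚ → ℕ → ℚ
expSum q zero    = 0ℚ
expSum q (suc n) = expSum q n ℚ.+ expTerm q n

module ExpLemmas where
  open ℚ
  open RationalLemmas
  open CauchyLemmas
  open ℚₚ.≤-Reasoning

  ∣c∣≤c : ∀ k → ∣ + 1 / suc k ∣ ≤ + 1 / suc k
  ∣c∣≤c k = ℚₚ.≤-reflexive (ℚₚ.0≤p⇒∣p∣≡p (0≤1/suc k))

  p≤p+q : ∀ {p q} → 0ℚ ≤ q → p ≤ p + q
  p≤p+q {p} 0≤q = ℚₚ.≤-trans (ℚₚ.≤-reflexive (sym (ℚₚ.+-identityʳ p))) (ℚₚ.+-monoʳ-≤ p 0≤q)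

  module _ {b} (0≤b : 0ℚ ≤ b) where

    0≤term : ∀ k → 0ℚ ≤ expTerm b k
    0≤term zero    = ℚₚ.nonNegative⁻¹ 1ℚ
    0≤term (suc k) = 0≤* (0≤* (0≤term k) 0≤b) (0≤1/suc k)

    ∣term∣≤ : ∀ {q} → ∣ q ∣ ≤ b → ∀ k → ∣ expTerm q k ∣ ≤ expTerm b k
    ∣term∣≤ h zero    = ℚₚ.≤-refl
    ∣term∣≤ h (suc k) = ∣*∣-mono-≤ (∣*∣-mono-≤ (∣term∣≤ h k) h) (∣c∣≤c k)

    term-suc-* : ∀ k → expTerm b (suc k) * ι (suc k) ≡ expTerm b k * b
    term-suc-* k = trans (ℚₚ.*-assoc (expTerm b k * b) _ _)
      (trans (cong (expTerm b k * b *_) (1/suc k)) (ℚₚ.*-identityʳ _))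

    module _ {p q} (hp : ∣ p ∣ ≤ b) (hq : ∣ q ∣ ≤ b) where

      d : ℚ
      d = ∣ p - q ∣

      term-lip  : ∀ k → ∣ expTerm p (suc k) - expTerm q (suc k) ∣ ≤ d * expTerm b k
      term-lip′ : ∀ k → ∣ expTerm p k - expTerm q k ∣ * b ≤ ι k * (d * expTerm b k)

      term-lip k = begin
        ∣ tp * p * c - tq * q * c ∣                  ≡⟨ cong ∣_∣ (regroup tp p tq q c) ⟩
        ∣ (tp * (p - q) + (tp - tq) * q) * c ∣       ≤⟨ ∣*∣-mono-≤ inner (∣c∣≤c k) ⟩
        (ι (suc k) * (d * tb)) * c                   ≡⟨ rotate (ι (suc k)) (d * tb) c ⟩
        (c * ι (suc k)) * (d * tb)                   ≡⟨ cong (_* (d * tb)) (1/suc k) ⟩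
        1ℚ * (d * tb)                                ≡⟨ ℚₚ.*-identityˡ (d * tb) ⟩
        d * tb                                       ∎
        where
        tp tq tb c : ℚ
        tp = expTerm p k
        tq = expTerm q k
        tb = expTerm b k
        c  = + 1 / suc k
        regroup : ∀ t p u q c → t * p * c - u * q * c ≡ (t * (p - q) + (t - u) * q) * c
        regroup = solve 5 (λ t p u q c →
          t :* p :* c :- u :* q :* c := (t :* (p :- q) :+ (t :- u) :* q) :* c) refl
          where open +-*-Solver
        rotate : ∀ a b c → a * b * c ≡ c * a * b
        rotate = solve 3 (λ a b c → a :* b :* c := c :* a :* b) refl
          where open +-*-Solver
        inner : ∣ tp * (p - q) + (tp - tq) * q ∣ ≤ ι (suc k) * (d * tb)
        inner = begin
          ∣ tp * (p - q) + (tp - tq) * q ∣           ≤⟨ ℚₚ.∣p+q∣≤∣p∣+∣q∣ (tp * (p - q)) ((tp - tq) * q) ⟩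
          ∣ tp * (p - q) ∣ + ∣ (tp - tq) * q ∣       ≤⟨ ℚₚ.+-mono-≤
              (∣*∣-mono-≤ (∣term∣≤ hp k) (ℚₚ.≤-refl {d}))
              (∣*∣-mono-≤ (ℚₚ.≤-refl {∣ tp - tq ∣}) hq) ⟩
          tb * d + ∣ tp - tq ∣ * b                   ≤⟨ ℚₚ.+-monoʳ-≤ (tb * d) (term-lip′ k) ⟩
          tb * d + ι k * (d * tb)                    ≡⟨ collect tb d (ι k) ⟩
          (1ℚ + ι k) * (d * tb)                      ≡⟨ cong (_* (d * tb)) (sym (ι-suc k)) ⟩
          ι (suc k) * (d * tb)                       ∎
          where
          collect : ∀ t d i → t * d + i * (d * t) ≡ (1ℚ + i) * (d * t)
          collect = solve 3 (λ t d i → t :* d :+ i :* (d :* t) := (con 1ℚ :+ i) :* (d :* t)) refl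
            where open +-*-Solver

      term-lip′ zero = ℚₚ.≤-reflexive
        (trans (cong (_* b) (∣p-p∣≡0 1ℚ)) (trans (ℚₚ.*-zeroˡ b) (sym (ℚₚ.*-zeroˡ (d * expTerm b zero)))))
      term-lip′ (suc k) = begin
        ∣ expTerm p (suc k) - expTerm q (suc k) ∣ * b
          ≤⟨ ℚₚ.*-monoʳ-≤-nonNeg b {{ℚ.nonNegative 0≤b}} (term-lip k) ⟩
        d * expTerm b k * b                          ≡⟨ ℚₚ.*-assoc d _ b ⟩
        d * (expTerm b k * b)                        ≡⟨ cong (d *_) (sym (term-suc-* k)) ⟩
        d * (expTerm b (suc k) * ι (suc k))          ≡⟨ rotate d (expTerm b (suc k)) (ι (suc k)) ⟩
        ι (suc k) * (d * expTerm b (suc k))          ∎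
        where
        rotate : ∀ a b c → a * (b * c) ≡ c * (a * b)
        rotate = solve 3 (λ a b c → a :* (b :* c) := c :* (a :* b)) refl
          where open +-*-Solver

      sum-lip : ∀ n → ∣ expSum p (suc n) - expSum q (suc n) ∣ ≤ d * expSum b n
      sum-lip zero    = ℚₚ.≤-reflexive (sym (ℚₚ.*-zeroʳ d))
      sum-lip (suc n) = begin
        ∣ (sp + tp) - (sq + tq) ∣                    ≡⟨ cong ∣_∣ (regroup sp tp sq tq) ⟩
        ∣ (sp - sq) + (tp - tq) ∣                    ≤⟨ ℚₚ.∣p+q∣≤∣p∣+∣q∣ (sp - sq) (tp - tq) ⟩
        ∣ sp - sq ∣ + ∣ tp - tq ∣                    ≤⟨ ℚₚ.+-mono-≤ (sum-lip n) (term-lip n) ⟩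
        d * expSum b n + d * expTerm b n             ≡⟨ sym (ℚₚ.*-distribˡ-+ d _ _) ⟩
        d * expSum b (suc n)                         ∎
        where
        sp sq tp tq : ℚ
        sp = expSum p (suc n)
        sq = expSum q (suc n)
        tp = expTerm p (suc n)
        tq = expTerm q (suc n)
        regroup : ∀ a b c d → (a + b) - (c + d) ≡ (a - c) + (b - d)
        regroup = solve 4 (λ a b c d → (a :+ b) :- (c :+ d) := (a :- c) :+ (b :- d)) refl
          where open +-*-Solver

    0≤expSum : ∀ n → 0ℚ ≤ expSum b n
    0≤expSum zero    = ℚₚ.≤-refl
    0≤expSum (suc n) = ℚₚ.≤-trans (0≤expSum n) (p≤p+q (0≤term n))

    ∣sum-diff∣≤ : ∀ {q} → ∣ q ∣ ≤ b → ∀ j n →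
                  ∣ expSum q (j ℕ.+ n) - expSum q n ∣ ≤ expSum b (j ℕ.+ n) - expSum b n
    ∣sum-diff∣≤ {q} h zero    n = ℚₚ.≤-reflexive
      (trans (∣p-p∣≡0 (expSum q n)) (sym (ℚₚ.+-inverseʳ (expSum b n))))
    ∣sum-diff∣≤ {q} h (suc j) n = begin
      ∣ s + t - s₀ ∣                 ≡⟨ cong ∣_∣ (regroup s t s₀) ⟩
      ∣ (s - s₀) + t ∣               ≤⟨ ℚₚ.∣p+q∣≤∣p∣+∣q∣ (s - s₀) t ⟩
      ∣ s - s₀ ∣ + ∣ t ∣             ≤⟨ ℚₚ.+-mono-≤ (∣sum-diff∣≤ h j n) (∣term∣≤ h (j ℕ.+ n)) ⟩
      (expSum b (j ℕ.+ n) - expSum b n) + expTerm b (j ℕ.+ n)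
                                     ≡⟨ sym (regroup (expSum b (j ℕ.+ n)) _ (expSum b n)) ⟩
      expSum b (suc j ℕ.+ n) - expSum b n ∎
      where
      s t s₀ : ℚ
      s  = expSum q (j ℕ.+ n)
      t  = expTerm q (j ℕ.+ n)
      s₀ = expSum q n
      regroup : ∀ a b c → a + b - c ≡ (a - c) + b
      regroup = solve 3 (λ a b c → a :+ b :- c := (a :- c) :+ b) refl
        where open +-*-Solver

    -- From index K ≥ 2b on, consecutive terms at least halve.
    module _ {K} (2b≤K : b + b ≤ ι K) where

      halve : ∀ k → K ℕ.≤ k → expTerm b (suc k) + expTerm b (suc k) ≤ expTerm b k
      halve k K≤k = begin
        t′ + t′                                ≡⟨ double t b c ⟩
        t * (b + b) * c                        ≤⟨ ℚₚ.*-monoʳ-≤-nonNeg c {{ℚ.nonNegative (0≤1/suc k)}}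
             (ℚₚ.*-monoˡ-≤-nonNeg t {{ℚ.nonNegative (0≤term k)}}
               (ℚₚ.≤-trans 2b≤K (ι-mono (ℕₚ.m≤n⇒m≤1+n K≤k)))) ⟩
        t * ι (suc k) * c                      ≡⟨ rotate t (ι (suc k)) c ⟩
        t * (c * ι (suc k))                    ≡⟨ cong (t *_) (1/suc k) ⟩
        t * 1ℚ                                 ≡⟨ ℚₚ.*-identityʳ t ⟩
        t                                      ∎
        where
        t t′ c : ℚ
        t  = expTerm b k
        t′ = expTerm b (suc k)
        c  = + 1 / suc k
        double : ∀ t b c → t * b * c + t * b * c ≡ t * (b + b) * c
        double = solve 3 (λ t b c → t :* b :* c :+ t :* b :* c := t :* (b :+ b) :* c) refl
          where open +-*-Solver
        rotate : ∀ a b c → a * b * c ≡ a * (c * b)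
        rotate = solve 3 (λ a b c → a :* b :* c := a :* (c :* b)) refl
          where open +-*-Solver

      sum+2term-antitone : ∀ j n → K ℕ.≤ n →
        expSum b (j ℕ.+ n) + (expTerm b (j ℕ.+ n) + expTerm b (j ℕ.+ n))
          ≤ expSum b n + (expTerm b n + expTerm b n)
      sum+2term-antitone zero    n K≤n = ℚₚ.≤-refl
      sum+2term-antitone (suc j) n K≤n = begin
        s + t + (t′ + t′)  ≤⟨ ℚₚ.+-monoʳ-≤ (s + t) (halve (j ℕ.+ n) (ℕₚ.m≤n⇒m≤o+n j K≤n)) ⟩
        s + t + t          ≡⟨ ℚₚ.+-assoc s t t ⟩
        s + (t + t)        ≤⟨ sum+2term-antitone j n K≤n ⟩
        expSum b n + (expTerm b n + expTerm b n) ∎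
        where
        s t t′ : ℚ
        s  = expSum b (j ℕ.+ n)
        t  = expTerm b (j ℕ.+ n)
        t′ = expTerm b (suc j ℕ.+ n)

      sum-diff≤ : ∀ j n → K ℕ.≤ n →
        expSum b (j ℕ.+ n) - expSum b n ≤ expTerm b n + expTerm b n
      sum-diff≤ j n K≤n = p-q≤r (begin
        expSum b (j ℕ.+ n)                       ≤⟨ p≤p+q (0≤t+t (j ℕ.+ n)) ⟩
        expSum b (j ℕ.+ n) + (expTerm b (j ℕ.+ n) + expTerm b (j ℕ.+ n))
                                                 ≤⟨ sum+2term-antitone j n K≤n ⟩
        expSum b n + (expTerm b n + expTerm b n) ∎)
        where
        0≤t+t : ∀ k → 0ℚ ≤ expTerm b k + expTerm b k
        0≤t+t k = ℚₚ.≤-trans (ℚₚ.≤-reflexive (sym (ℚₚ.+-identityʳ 0ℚ)))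
                    (ℚₚ.+-mono-≤ (0≤term k) (0≤term k))

      term-decay : ∀ j → ι (suc j) * expTerm b (j ℕ.+ K) ≤ expTerm b K
      term-decay zero    = ℚₚ.≤-reflexive (ℚₚ.*-identityˡ _)
      term-decay (suc j) = begin
        ι (2 ℕ.+ j) * t′        ≤⟨ ℚₚ.*-monoʳ-≤-nonNeg t′ {{ℚ.nonNegative (0≤term (suc j ℕ.+ K))}} step ⟩
        (ι (suc j) + ι (suc j)) * t′ ≡⟨ double (ι (suc j)) t′ ⟩
        ι (suc j) * (t′ + t′)   ≤⟨ ℚₚ.*-monoˡ-≤-nonNeg (ι (suc j)) (halve (j ℕ.+ K) (ℕₚ.m≤n+m K j)) ⟩
        ι (suc j) * expTerm b (j ℕ.+ K) ≤⟨ term-decay j ⟩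
        expTerm b K             ∎
        where
        t′ : ℚ
        t′ = expTerm b (suc j ℕ.+ K)
        double : ∀ i t → (i + i) * t ≡ i * (t + t)
        double = solve 2 (λ i t → (i :+ i) :* t := i :* (t :+ t)) refl
          where open +-*-Solver
        step : ι (2 ℕ.+ j) ≤ ι (suc j) + ι (suc j)
        step = ℚₚ.≤-trans (ℚₚ.≤-reflexive (ι-suc (suc j)))
                 (ℚₚ.+-monoˡ-≤ (ι (suc j)) (ι-mono {1} {suc j} (s≤s ℕ.z≤n)))

      term-small : ∀ {δ} → 0ℚ < δ → ∃ λ N → K ℕ.≤ N × expTerm b N ≤ δ
      term-small {δ} 0<δ with archimedean-* (expTerm b K) 0<δ
      ... | j , h = j ℕ.+ K , ℕₚ.m≤n+m K j ,
        ℚₚ.*-cancelˡ-≤-pos (ι (suc j)) (begin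
          ι (suc j) * expTerm b (j ℕ.+ K) ≤⟨ term-decay j ⟩
          expTerm b K                     ≤⟨ h ⟩
          ι j * δ                         ≤⟨ ℚₚ.*-monoʳ-≤-nonNeg δ {{ℚ.nonNegative (ℚₚ.<⇒≤ 0<δ)}} (ι-mono (ℕₚ.n≤1+n j)) ⟩
          ι (suc j) * δ                   ∎)

      sum-tail : ∀ {δ} → 0ℚ < δ → ∃ λ N → K ℕ.≤ N ×
                 (∀ {q} → ∣ q ∣ ≤ b → ∀ n → N ℕ.≤ n → ∣ expSum q n - expSum q N ∣ ≤ δ)
      sum-tail {δ} 0<δ with term-small (0<½* 0<δ)
      ... | N , K≤N , hN = N , K≤N , λ {q} h n N≤n →
        subst (λ m → ∣ expSum q m - expSum q N ∣ ≤ δ) (ℕₚ.m∸n+n≡m N≤n) (begin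
          ∣ expSum q (n ℕ.∸ N ℕ.+ N) - expSum q N ∣  ≤⟨ ∣sum-diff∣≤ h (n ℕ.∸ N) N ⟩
          expSum b (n ℕ.∸ N ℕ.+ N) - expSum b N      ≤⟨ sum-diff≤ (n ℕ.∸ N) N K≤N ⟩
          expTerm b N + expTerm b N                  ≤⟨ ℚₚ.+-mono-≤ hN hN ⟩
          ½* δ + ½* δ                                ≡⟨ ½+½ δ ⟩
          δ                                          ∎)

  abstract
    exp-cauchy : ∀ {x} → Cauchy x → Cauchy (λ n → expSum (x n) n)
    exp-cauchy {x} cx δ 0<δ =
      let B , L , hB       = bounded cx
          K , 2B≤K         = archimedean (ι B + ι B)
          N , K≤N , tail   = sum-tail (0≤ι B) {K} 2B≤K (0<½* (0<½* 0<δ))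
          σ , 0<σ , hσ     = shrink (expSum (ι B) N) (0≤expSum (0≤ι B) N) (0<½* 0<δ)
          M , hx           = cx σ 0<σ
      in combine B L N M σ hB tail hσ hx
      where
      S : ℕ → ℕ → ℚ
      S m k = expSum (x m) k
      q : ℚ
      q = ½* (½* δ)
      total : q + (½* δ + q) ≡ δ
      total = solve 1 (λ δ → con ½ :* (con ½ :* δ) :+ (con ½ :* δ :+ con ½ :* (con ½ :* δ)) := δ) refl δ
        where open +-*-Solver
      lip : ∀ B m n → ∣ x m ∣ ≤ ι B → ∣ x n ∣ ≤ ι B → ∀ k →
            ∣ S m k - S n k ∣ ≤ ∣ x m - x n ∣ * expSum (ι B) k
      lip B m n bm bn zero    = ℚₚ.≤-reflexive (sym (ℚₚ.*-zeroʳ ∣ x m - x n ∣))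
      lip B m n bm bn (suc k) = ℚₚ.≤-trans (sum-lip (0≤ι B) bm bn k)
        (ℚₚ.*-monoˡ-≤-nonNeg ∣ x m - x n ∣ {{ℚₚ.∣-∣-nonNeg (x m - x n)}}
          (p≤p+q (0≤term (0≤ι B) k)))
      combine : ∀ B L N M σ → (∀ n → L ℕ.≤ n → ∣ x n ∣ ≤ ι B) →
        (∀ {q′} → ∣ q′ ∣ ≤ ι B → ∀ n → N ℕ.≤ n → ∣ expSum q′ n - expSum q′ N ∣ ≤ q) →
        σ * expSum (ι B) N ≤ ½* δ →
        (∀ m n → M ℕ.≤ m → M ℕ.≤ n → ∣ x m - x n ∣ ≤ σ) →
        ∃ λ J → ∀ m n → J ℕ.≤ m → J ℕ.≤ n → ∣ S m m - S n n ∣ ≤ δ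
      combine B L N M σ hB tail hσ hx = N ℕ.⊔ (L ℕ.⊔ M) , λ m n hm hn →
        let N≤m  = ℕₚ.m⊔n≤o⇒m≤o N (L ℕ.⊔ M) hm
            N≤n  = ℕₚ.m⊔n≤o⇒m≤o N (L ℕ.⊔ M) hn
            LM≤m = ℕₚ.m⊔n≤o⇒n≤o N (L ℕ.⊔ M) hm
            LM≤n = ℕₚ.m⊔n≤o⇒n≤o N (L ℕ.⊔ M) hn
            bm   = hB m (ℕₚ.m⊔n≤o⇒m≤o L M LM≤m)
            bn   = hB n (ℕₚ.m⊔n≤o⇒m≤o L M LM≤n)
            D    = expSum (ι B) N
        in begin
        ∣ S m m - S n n ∣                           ≤⟨ triangle (S m m) (S m N) (S n n) ⟩
        ∣ S m m - S m N ∣ + ∣ S m N - S n n ∣       ≤⟨ ℚₚ.+-mono-≤ (tail bm m N≤m)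
                                                         (triangle (S m N) (S n N) (S n n)) ⟩
        q + (∣ S m N - S n N ∣ + ∣ S n N - S n n ∣) ≤⟨ ℚₚ.+-monoʳ-≤ q (ℚₚ.+-mono-≤
          (ℚₚ.≤-trans (lip B m n bm bn N) (ℚₚ.*-monoʳ-≤-nonNeg D {{ℚ.nonNegative (0≤expSum (0≤ι B) N)}}
            (hx m n (ℕₚ.m⊔n≤o⇒n≤o L M LM≤m) (ℕₚ.m⊔n≤o⇒n≤o L M LM≤n))))
          (ℚₚ.≤-trans (ℚₚ.≤-reflexive (∣p-q∣≡∣q-p∣ (S n N) (S n n))) (tail bn n N≤n))) ⟩
        q + (σ * D + q)                             ≤⟨ ℚₚ.+-monoʳ-≤ q (ℚₚ.+-monoˡ-≤ q hσ) ⟩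
        q + (½* δ + q)                              ≡⟨ total ⟩
        δ                                           ∎

infix  4 _≤ℝ_ _<ℝ_ _≈ℝ_ _⟶_
infixl 6 _+ℝ_ _-ℝ_
infixl 7 _*ℝ_

fromℚ : ℚ → ℝ
fromℚ q = mkℝ (λ _ → q) (CauchyLemmas.const-cauchy q)

fromℕ : ℕ → ℝ
fromℕ n = fromℚ (ι n)

0ℝ 1ℝ : ℝ
0ℝ = fromℚ 0ℚ
1ℝ = fromℚ 1ℚ

_+ℝ_ : ℝ → ℝ → ℝ
x +ℝ y = mkℝ (λ n → seq x n ℚ.+ seq y n) (CauchyLemmas.+-cauchy {seq x} {seq y} (cauchy x) (cauchy y))

-ℝ_ : ℝ → ℝ
-ℝ x = mkℝ (λ n → ℚ.- seq x n) (CauchyLemmas.neg-cauchy {seq x} (cauchy x))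

_-ℝ_ : ℝ → ℝ → ℝ
x -ℝ y = x +ℝ (-ℝ y)

_*ℝ_ : ℝ → ℝ → ℝ
x *ℝ y = mkℝ (λ n → seq x n ℚ.* seq y n) (CauchyLemmas.*-cauchy {seq x} {seq y} (cauchy x) (cauchy y))

∣_∣ℝ : ℝ → ℝ
∣ x ∣ℝ = mkℝ (λ n → ℚ.∣ seq x n ∣) (CauchyLemmas.abs-cauchy {seq x} (cauchy x))

exp : ℝ → ℝ
exp x = mkℝ (λ n → expSum (seq x n) n) (ExpLemmas.exp-cauchy {seq x} (cauchy x))

record _≤ℝ_ (x y : ℝ) : Set where
  constructor mk≤
  field
    eventually≤ : ∀ δ → 0ℚ ℚ.< δ → ∃[ N ] (∀ n → N ℕ.≤ n → seq x n ℚ.≤ seq y n ℚ.+ δ)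

open _≤ℝ_ public

_<ℝ_ : ℝ → ℝ → Set
x <ℝ y = ∃[ δ ] 0ℚ ℚ.< δ × ∃[ N ] (∀ n → N ℕ.≤ n → seq x n ℚ.+ δ ℚ.≤ seq y n)

_≈ℝ_ : ℝ → ℝ → Set
x ≈ℝ y = x ≤ℝ y × y ≤ℝ x

_⟶_ : (ℕ → ℝ) → ℝ → Set
x ⟶ l = ∀ δ → 0ℚ ℚ.< δ → ∃[ N ] (∀ n → N ℕ.≤ n → ∣ x n -ℝ l ∣ℝ ≤ℝ fromℚ δ)

partialSum : (ℕ → ℝ) → ℕ → ℝ
partialSum x zero    = 0ℝ
partialSum x (suc n) = partialSum x n +ℝ x n

Output : ℕ → Set
Output T = Fin T → ℝ

-- Closed boxes generate the Borel σ-algebra of ℝᵀ.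
data Borel {T} : Pred (Output T) 0ℓ → Set₁ where
  box        : (l u : Output T) → Borel (λ y → ∀ t → l t ≤ℝ y t × y t ≤ℝ u t)
  whole      : Borel U
  complement : ∀ {S} → Borel S → Borel (∁ S)
  union      : ∀ {S : ℕ → Pred (Output T) 0ℓ} → (∀ i → Borel (S i)) → Borel (⋃ ℕ S)
  respects   : ∀ {S S′} → S ≐ S′ → Borel S → Borel S′

record ProbabilityMeasure (T : ℕ) : Set₁ where
  field
    Pr            : (S : Pred (Output T) 0ℓ) → Borel S → ℝ
    Pr-cong       : ∀ {S S′} (b : Borel S) (b′ : Borel S′) → S ≐ S′ → Pr S b ≈ℝ Pr S′ b′
    Pr-nonNeg     : ∀ {S} (b : Borel S) → 0ℝ ≤ℝ Pr S b
    Pr-whole      : Pr U whole ≈ℝ 1ℝ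
    -- Classically this follows from the other laws; without excluded middle it
    -- does not, because S and ∁ S need not exhaust the space.
    Pr-complement : ∀ {S} (b : Borel S) → Pr S b +ℝ Pr (∁ S) (complement b) ≈ℝ 1ℝ
    Pr-σ-additive : ∀ {S : ℕ → Pred (Output T) 0ℓ} (b : ∀ i → Borel (S i)) →
                    (∀ {i j y} → S i y → S j y → i ≡ j) →
                    partialSum (λ i → Pr (S i) (b i)) ⟶ Pr (⋃ ℕ S) (union b)

open ProbabilityMeasure public

-- An undirected edge is stored once, with its smaller endpoint first; there
-- are no loops.
record Edge : Set where
  constructor edge
  field
    lo hi  : ℕ
    weight : ℕ
    .lo<hi : lo ℕ.< hi

open Edge public

Incident : ℕ → Edge → Set
Incident v e = v ≡ lo e ⊎ v ≡ hi e

Adjacent : List Edge → ℕ → ℕ → Set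
Adjacent es u v = ∃[ e ] e ∈ es × ((u ≡ lo e × v ≡ hi e) ⊎ (u ≡ hi e × v ≡ lo e))

-- The lists stand for finite sets: only membership matters.
record Graph : Set where
  constructor graph
  field
    nodes : List ℕ
    edges : List Edge

open Graph public

record IsGraph (W : ℕ) (G : Graph) : Set where
  field
    endpoints : ∀ {e} → e ∈ edges G → lo e ∈ nodes G × hi e ∈ nodes G
    simple    : ∀ {e e′} → e ∈ edges G → e′ ∈ edges G → lo e ≡ lo e′ → hi e ≡ hi e′ → e ≡ e′
    weights   : ∀ {e} → e ∈ edges G → 1 ℕ.≤ weight e × weight e ℕ.≤ W

record IsCycle (es : List Edge) (v : ℕ) (vs : List ℕ) : Set where
  field
    distinct : Unique (v ∷ vs)
    long     : 3 ℕ.≤ length (v ∷ vs)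
    closed   : Linked (Adjacent es) (v ∷ vs ∷ʳ v)

Connected : List Edge → ℕ → ℕ → Set
Connected es = Star (Adjacent es)

record IsSpanningForest (G : Graph) (F : List Edge) : Set where
  field
    unique   : Unique F
    subgraph : F ⊆ edges G
    acyclic  : ∀ v vs → ¬ IsCycle F v vs
    spanning : ∀ {u v} → Connected (edges G) u v → Connected F u v

totalWeight : List Edge → ℕ
totalWeight F = sum (map weight F)

record IsMSTWeight (G : Graph) (w : ℕ) : Set where
  field
    attained : ∃[ F ] IsSpanningForest G F × totalWeight F ≡ w
    minimal  : ∀ F → IsSpanningForest G F → w ℕ.≤ totalWeight F

record Insertion : Set where
  constructor insertion
  field
    newNodes : List ℕ
    newEdges : List Edge

open Insertion public

insert : Graph → Insertion → Graph
insert G δ = graph (newNodes δ ++ nodes G) (newEdges δ ++ edges G)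

-- Time steps are numbered from zero.
graphBefore : ∀ {T} → Graph → (Fin T → Insertion) → Fin T → Graph
graphBefore G δ zero    = G
graphBefore G δ (suc t) = graphBefore (insert G (δ zero)) (δ ∘ suc) t

graphAfter : ∀ {T} → Graph → (Fin T → Insertion) → Fin T → Graph
graphAfter G δ t = insert (graphBefore G δ t) (δ t)

record IncrementalSequence (W T : ℕ) : Set where
  field
    initial    : Graph
    insertions : Fin T → Insertion

  before : Fin T → Graph
  before = graphBefore initial insertions

  after : Fin T → Graph
  after = graphAfter initial insertions

  ∂V : Fin T → List ℕ
  ∂V t = newNodes (insertions t)

  ∂E : Fin T → List Edge
  ∂E t = newEdges (insertions t)

  field
    initial-isGraph : IsGraph W initial
    after-isGraph   : ∀ t → IsGraph W (after t)
    ∂V-new          : ∀ t {v} → v ∈ ∂V t → v ∉ nodes (before t)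
    ∂E-new          : ∀ t {e} → e ∈ ∂E t → e ∉ edges (before t)

open IncrementalSequence public

SameGraph : Graph → Graph → Set
SameGraph G G′ = (nodes G ∼[ set ] nodes G′) × (edges G ∼[ set ] edges G′)

record OmitsNode {W T} (𝒢 𝒢′ : IncrementalSequence W T) : Set where
  field
    v*         : ℕ
    t*         : Fin T
    initial-≡  : SameGraph (initial 𝒢) (initial 𝒢′)
    ∂V-≢t*     : ∀ t → t ≢ t* → ∂V 𝒢 t ∼[ set ] ∂V 𝒢′ t
    ∂V-⊆       : ∂V 𝒢′ t* ⊆ ∂V 𝒢 t*
    ∂V-∖       : ∀ v → (v ∈ ∂V 𝒢 t* × v ∉ ∂V 𝒢′ t*) ⇔ v ≡ v*
    ∂E-at-new  : ∀ t {e} → e ∈ ∂E 𝒢 t → ∃[ v ] v ∈ ∂V 𝒢 t × Incident v e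
    ∂E-maximal : ∀ t e → e ∈ ∂E 𝒢′ t ⇔ (e ∈ ∂E 𝒢 t × ¬ Incident v* e)

NodeAdjacent : ∀ {W T} → IncrementalSequence W T → IncrementalSequence W T → Set
NodeAdjacent 𝒢 𝒢′ = OmitsNode 𝒢 𝒢′ ⊎ OmitsNode 𝒢′ 𝒢

AgreeUpTo : ∀ {W T} → Fin T → IncrementalSequence W T → IncrementalSequence W T → Set
AgreeUpTo t 𝒢 𝒢′ = SameGraph (initial 𝒢) (initial 𝒢′) ×
  (∀ s → s Fin.≤ t → (∂V 𝒢 s ∼[ set ] ∂V 𝒢′ s) × (∂E 𝒢 s ∼[ set ] ∂E 𝒢′ s))

DeterminedUpTo : ∀ {T} → Fin T → Pred (Output T) 0ℓ → Set
DeterminedUpTo t S = ∀ y y′ → (∀ s → s Fin.≤ t → y s ≈ℝ y′ s) → S y → S y′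

-- A randomized algorithm is given by the laws of its output sequences.  That
-- it outputs a number after each time step is the condition `online`: the law
-- of the outputs up to time t depends only on the input up to time t.
record Algorithm (W T : ℕ) : Set₁ where
  field
    law    : IncrementalSequence W T → ProbabilityMeasure T
    online : ∀ t {𝒢 𝒢′} → AgreeUpTo t 𝒢 𝒢′ →
             ∀ {S} (b : Borel S) → DeterminedUpTo t S → Pr (law 𝒢) S b ≈ℝ Pr (law 𝒢′) S b

open Algorithm public

NodePrivate : ∀ {W T} → ℝ → Algorithm W T → Set₁
NodePrivate ε A = ∀ 𝒢 𝒢′ → NodeAdjacent 𝒢 𝒢′ →
  ∀ {S} (b : Borel S) → Pr (law A 𝒢) S b ≤ℝ exp ε *ℝ Pr (law A 𝒢′) S b

Within : ∀ {T} → ℝ → (Fin T → ℕ) → Pred (Output T) 0ℓ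
Within α w y = ∀ t → ∣ y t -ℝ fromℕ (w t) ∣ℝ ≤ℝ α

module WithinLemmas where
  open RationalLemmas
  open +-*-Solver
  open ℚₚ.≤-Reasoning

  -≤ : ∀ v a y δ → v ℚ.- a ℚ.≤ y ℚ.+ δ → ℚ.- (y ℚ.- v) ℚ.≤ a ℚ.+ δ
  -≤ v a y δ h = begin
    ℚ.- (y ℚ.- v)           ≡⟨ solve 3 (λ v a y → :- (y :- v) := (v :- a) :+ (a :- y)) refl v a y ⟩
    (v ℚ.- a) ℚ.+ (a ℚ.- y) ≤⟨ ℚₚ.+-monoˡ-≤ (a ℚ.- y) h ⟩
    (y ℚ.+ δ) ℚ.+ (a ℚ.- y) ≡⟨ solve 3 (λ a y δ → (y :+ δ) :+ (a :- y) := a :+ δ) refl a y δ ⟩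
    a ℚ.+ δ                 ∎

  -≤⁻¹ : ∀ v a y δ → ℚ.- (y ℚ.- v) ℚ.≤ a ℚ.+ δ → v ℚ.- a ℚ.≤ y ℚ.+ δ
  -≤⁻¹ v a y δ h = begin
    v ℚ.- a                       ≡⟨ solve 3 (λ v a y → v :- a := :- (y :- v) :+ (y :- a)) refl v a y ⟩
    ℚ.- (y ℚ.- v) ℚ.+ (y ℚ.- a)   ≤⟨ ℚₚ.+-monoˡ-≤ (y ℚ.- a) h ⟩
    (a ℚ.+ δ) ℚ.+ (y ℚ.- a)       ≡⟨ solve 3 (λ a y δ → (a :+ δ) :+ (y :- a) := y :+ δ) refl a y δ ⟩
    y ℚ.+ δ                       ∎

  +≤ : ∀ v a y δ → y ℚ.≤ (v ℚ.+ a) ℚ.+ δ → y ℚ.- v ℚ.≤ a ℚ.+ δ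
  +≤ v a y δ h = p-q≤r (ℚₚ.≤-trans h (ℚₚ.≤-reflexive (ℚₚ.+-assoc v a δ)))

  +≤⁻¹ : ∀ v a y δ → y ℚ.- v ℚ.≤ a ℚ.+ δ → y ℚ.≤ (v ℚ.+ a) ℚ.+ δ
  +≤⁻¹ v a y δ h = begin
    y                       ≡⟨ solve 2 (λ v y → y := v :+ (y :- v)) refl v y ⟩
    v ℚ.+ (y ℚ.- v)         ≤⟨ ℚₚ.+-monoʳ-≤ v h ⟩
    v ℚ.+ (a ℚ.+ δ)         ≡⟨ sym (ℚₚ.+-assoc v a δ) ⟩
    (v ℚ.+ a) ℚ.+ δ         ∎

  interval⇒within : ∀ {α v y} → v -ℝ α ≤ℝ y → y ≤ℝ v +ℝ α → ∣ y -ℝ v ∣ℝ ≤ℝ α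
  interval⇒within {α} {v} {y} h h′ = mk≤ λ δ 0<δ →
    let N , hN = eventually≤ h δ 0<δ
        M , hM = eventually≤ h′ δ 0<δ
    in N ℕ.⊔ M , λ n hn → ∣p∣≤r
      (+≤ (seq v n) (seq α n) (seq y n) δ (hM n (ℕₚ.m⊔n≤o⇒n≤o N M hn)))
      (-≤ (seq v n) (seq α n) (seq y n) δ (hN n (ℕₚ.m⊔n≤o⇒m≤o N M hn)))

  within⇒lower : ∀ {α v y} → ∣ y -ℝ v ∣ℝ ≤ℝ α → v -ℝ α ≤ℝ y
  within⇒lower {α} {v} {y} h = mk≤ λ δ 0<δ →
    let N , hN = eventually≤ h δ 0<δ
    in N , λ n hn → -≤⁻¹ (seq v n) (seq α n) (seq y n) δ
      (ℚₚ.≤-trans (p≤∣p∣ (ℚ.- (seq y n ℚ.- seq v n)))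
        (ℚₚ.≤-trans (ℚₚ.≤-reflexive (ℚₚ.∣-p∣≡∣p∣ (seq y n ℚ.- seq v n))) (hN n hn)))

  within⇒upper : ∀ {α v y} → ∣ y -ℝ v ∣ℝ ≤ℝ α → y ≤ℝ v +ℝ α
  within⇒upper {α} {v} {y} h = mk≤ λ δ 0<δ →
    let N , hN = eventually≤ h δ 0<δ
    in N , λ n hn → +≤⁻¹ (seq v n) (seq α n) (seq y n) δ
      (ℚₚ.≤-trans (p≤∣p∣ (seq y n ℚ.- seq v n)) (hN n hn))

within-borel : ∀ {T} α (w : Fin T → ℕ) → Borel (Within α w)
within-borel α w = respects
  ( (λ {y} h t → interval⇒within {α} {fromℕ (w t)} {y t} (proj₁ (h t)) (proj₂ (h t)))
  , (λ {y} h t → within⇒lower {α} {fromℕ (w t)} {y t} (h t)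
               , within⇒upper {α} {fromℕ (w t)} {y t} (h t)) )
  (box (λ t → fromℕ (w t) -ℝ α) (λ t → fromℕ (w t) +ℝ α))
  where open WithinLemmas

-- On every input, with probability at least p, all T outputs are within α of
-- the weights of minimum spanning forests of the current graphs.
HasAdditiveError : ∀ {W T} → Algorithm W T → (p α : ℝ) → Set
HasAdditiveError {W} {T} A p α = ∀ (𝒢 : IncrementalSequence W T) (w : Fin T → ℕ) →
  (∀ t → IsMSTWeight (after 𝒢 t) (w t)) → p ≤ℝ Pr (law A 𝒢) (Within α w) (within-borel α w)

{-# OPTIONS --safe #-}

-- Packing.  Start from a single hub and compare the T inputs in which k leaves
-- are attached to the hub, by edges of weight W, all at time i.  The minimum
-- spanning forest weighs kW from time i on and 0 before, so if twice the error
-- is below kW, the sets of accurate output sequences for different i are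
-- disjoint.  Each of these inputs is k node insertions away from the input
-- without insertions, under which each of the T sets therefore has probability
-- at least p·exp(-kε).  Hence T·p ≤ exp(kε), which fails for k a small multiple
-- of log T.
module Submission where

open import Defs
open import Data.Empty using (⊥)
open import Data.Fin.Base as Fin using (Fin; zero; suc; toℕ)
import Data.Fin.Properties as Finₚ
open import Data.Integer.Base as ℤ using (+_)
open import Data.List.Base using (List; []; _∷_; _++_; _∷ʳ_; length; map; downFrom)
open import Data.List.Membership.Propositional using (_∈_; _∉_)
open import Data.List.Membership.Propositional.Properties
  using (∈-map⁺; ∈-map⁻; ∈-++⁺ˡ; ∈-++⁺ʳ; ∈-++⁻; ∈-∃++; ∈-downFrom⁺; ∈-downFrom⁻)
open import Data.List.Relation.Binary.BagAndSetEquality using (_∼[_]_; set)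
open import Data.List.Relation.Binary.Permutation.Propositional using (_↭_)
import Data.List.Relation.Binary.Permutation.Propositional.Properties as ↭ₚ
open import Data.List.Relation.Binary.Subset.Propositional using (_⊆_)
open import Data.List.Relation.Binary.Subset.Propositional.Properties using (⊆∷∧∉⇒⊆)
open import Data.List.Relation.Unary.All using (All; []; _∷_)
open import Data.List.Relation.Unary.All.Properties using (All¬⇒¬Any)
open import Data.List.Relation.Unary.AllPairs using ([]; _∷_)
open import Data.List.Relation.Unary.Any using (here; there)
open import Data.List.Relation.Unary.Linked using (Linked; _∷_)
open import Data.List.Relation.Unary.Unique.Propositional using (Unique)
import Data.List.Relation.Unary.Unique.Propositional.Properties as Unique
open import Data.Nat.Base as ℕ using (ℕ; zero; suc; _≤_; z≤n; s≤s; s≤s⁻¹)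
open import Data.Nat.DivMod using (m≡m%n+[m/n]*n; m%n<n; m/n*n≤m)
import Data.Nat.ListAction.Properties as ListActionₚ
open import Data.Nat.Logarithm using (⌊log₂_⌋; ⌊log₂⌋-mono-≤; ⌊log₂[2^n]⌋≡n)
import Data.Nat.Properties as ℕₚ
open import Data.Nat.Solver using () renaming (module +-*-Solver to ℕ-Solver)
open import Data.Product.Base using (∃-syntax; _×_; _,_; proj₁)
open import Data.Rational.Base as ℚ using (ℚ; 0ℚ; 1ℚ)
import Data.Rational.Properties as ℚₚ
open import Data.Rational.Solver using (module +-*-Solver)
open import Data.Sum.Base using (inj₁; inj₂)
open import Function.Base using (_∘_; id)
open import Function.Bundles using (_⇔_; mk⇔)
open import Level using (0ℓ)
open import Relation.Binary.Construct.Closure.ReflexiveTransitive as Star using (_◅_)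
open import Relation.Binary.Definitions using (tri<; tri≈; tri>)
open import Relation.Binary.PropositionalEquality using (_≡_; _≢_; refl; sym; trans; cong; subst)
open import Relation.Nullary.Decidable.Core using (yes; no)
open import Relation.Nullary.Negation.Core using (¬_; contradiction)
open import Relation.Unary using (Pred; U; ∁; ⋃)

open RationalLemmas

-- Order and convergence of real numbers

ι-+ : ∀ m n → ι (m ℕ.+ n) ≡ ι m ℚ.+ ι n
ι-+ zero    n = sym (ℚₚ.+-identityˡ (ι n))
ι-+ (suc m) n = trans (ι-suc (m ℕ.+ n))
  (trans (cong (1ℚ ℚ.+_) (ι-+ m n))
  (trans (sym (ℚₚ.+-assoc 1ℚ (ι m) (ι n))) (cong (ℚ._+ ι n) (sym (ι-suc m)))))

ι-* : ∀ m n → ι (m ℕ.* n) ≡ ι m ℚ.* ι n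
ι-* zero    n = sym (ℚₚ.*-zeroˡ (ι n))
ι-* (suc m) n = trans (ι-+ n (m ℕ.* n))
  (trans (cong (ι n ℚ.+_) (ι-* m n))
  (trans (distrib (ι m) (ι n)) (cong (ℚ._* ι n) (sym (ι-suc m)))))
  where
  distrib : ∀ x y → y ℚ.+ x ℚ.* y ≡ (1ℚ ℚ.+ x) ℚ.* y
  distrib = solve 2 (λ x y → y :+ x :* y := (con 1ℚ :+ x) :* y) refl
    where open +-*-Solver

0<1ℚ : 0ℚ ℚ.< 1ℚ
0<1ℚ = ℚₚ.positive⁻¹ 1ℚ

Eventually : Pred ℕ 0ℓ → Set
Eventually P = ∃[ N ] (∀ n → N ≤ n → P n)

always : ∀ {P} → (∀ n → P n) → Eventually P
always h = 0 , λ n _ → h n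

eventually-map : ∀ {P Q} → (∀ n → P n → Q n) → Eventually P → Eventually Q
eventually-map f (N , hN) = N , λ n hn → f n (hN n hn)

eventually-zip : ∀ {P Q R} → (∀ n → P n → Q n → R n) → Eventually P → Eventually Q → Eventually R
eventually-zip f (N , hN) (M , hM) = N ℕ.⊔ M , λ n hn →
  f n (hN n (ℕₚ.m⊔n≤o⇒m≤o N M hn)) (hM n (ℕₚ.m⊔n≤o⇒n≤o N M hn))

eventually-witness : ∀ {P : Pred ℕ 0ℓ} → Eventually P → ∃[ n ] P n
eventually-witness (N , hN) = N , hN N ℕₚ.≤-refl

module _ where
  open ℚₚ.≤-Reasoning

  +δ-nonneg : ∀ p {δ} → 0ℚ ℚ.< δ → p ℚ.≤ p ℚ.+ δ
  +δ-nonneg p {δ} 0<δ = begin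
    p           ≡⟨ sym (ℚₚ.+-identityʳ p) ⟩
    p ℚ.+ 0ℚ    ≤⟨ ℚₚ.+-monoʳ-≤ p (ℚₚ.<⇒≤ 0<δ) ⟩
    p ℚ.+ δ     ∎

  pointwise≤⇒≤ℝ : ∀ {x y} → Eventually (λ n → seq x n ℚ.≤ seq y n) → x ≤ℝ y
  pointwise≤⇒≤ℝ {x} {y} h = mk≤ λ δ 0<δ →
    eventually-map (λ n p → ℚₚ.≤-trans p (+δ-nonneg (seq y n) 0<δ)) h

  pointwise≡⇒≤ℝ : ∀ {x y} → (∀ n → seq x n ≡ seq y n) → x ≤ℝ y
  pointwise≡⇒≤ℝ {x} {y} h = pointwise≤⇒≤ℝ {x} {y} (always (ℚₚ.≤-reflexive ∘ h))

  ≤ℝ-refl : ∀ {x} → x ≤ℝ x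
  ≤ℝ-refl {x} = pointwise≡⇒≤ℝ {x} {x} (λ _ → refl)

  ≤ℝ-trans : ∀ {x y z} → x ≤ℝ y → y ≤ℝ z → x ≤ℝ z
  ≤ℝ-trans {x} {y} {z} h h′ = mk≤ λ δ 0<δ → eventually-zip
    (λ n p q → begin
      seq x n                              ≤⟨ p ⟩
      seq y n ℚ.+ ½* δ                     ≤⟨ ℚₚ.+-monoˡ-≤ (½* δ) q ⟩
      seq z n ℚ.+ ½* δ ℚ.+ ½* δ            ≡⟨ ℚₚ.+-assoc (seq z n) (½* δ) (½* δ) ⟩
      seq z n ℚ.+ (½* δ ℚ.+ ½* δ)          ≡⟨ cong (seq z n ℚ.+_) (½+½ δ) ⟩
      seq z n ℚ.+ δ                        ∎)
    (eventually≤ h (½* δ) (0<½* 0<δ)) (eventually≤ h′ (½* δ) (0<½* 0<δ))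

  +ℝ-mono-≤ : ∀ {x y u v} → x ≤ℝ y → u ≤ℝ v → x +ℝ u ≤ℝ y +ℝ v
  +ℝ-mono-≤ {x} {y} {u} {v} h h′ = mk≤ λ δ 0<δ → eventually-zip
    (λ n p q → begin
      seq x n ℚ.+ seq u n                          ≤⟨ ℚₚ.+-mono-≤ p q ⟩
      (seq y n ℚ.+ ½* δ) ℚ.+ (seq v n ℚ.+ ½* δ)    ≡⟨ regroup (seq y n) (seq v n) (½* δ) ⟩
      (seq y n ℚ.+ seq v n) ℚ.+ (½* δ ℚ.+ ½* δ)    ≡⟨ cong ((seq y n ℚ.+ seq v n) ℚ.+_) (½+½ δ) ⟩
      (seq y n ℚ.+ seq v n) ℚ.+ δ                  ∎)
    (eventually≤ h (½* δ) (0<½* 0<δ)) (eventually≤ h′ (½* δ) (0<½* 0<δ))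
    where
    regroup : ∀ y v d → (y ℚ.+ d) ℚ.+ (v ℚ.+ d) ≡ (y ℚ.+ v) ℚ.+ (d ℚ.+ d)
    regroup = solve 3 (λ y v d → (y :+ d) :+ (v :+ d) := (y :+ v) :+ (d :+ d)) refl
      where open +-*-Solver

  x≤x+y : ∀ {x y} → 0ℝ ≤ℝ y → x ≤ℝ x +ℝ y
  x≤x+y {x} {y} 0≤y = ≤ℝ-trans {x} {x +ℝ 0ℝ} {x +ℝ y}
    (pointwise≡⇒≤ℝ {x} {x +ℝ 0ℝ} (λ n → sym (ℚₚ.+-identityʳ (seq x n))))
    (+ℝ-mono-≤ {x} {x} {0ℝ} {y} (≤ℝ-refl {x}) 0≤y)

  fromℚ-*ℝ-mono-≤ : ∀ {q x y} → 0ℚ ℚ.≤ q → x ≤ℝ y → fromℚ q *ℝ x ≤ℝ fromℚ q *ℝ y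
  fromℚ-*ℝ-mono-≤ {q} {x} {y} 0≤q h = mk≤ λ δ 0<δ →
    let σ , 0<σ , σq≤δ = CauchyLemmas.shrink q 0≤q 0<δ in
    eventually-map
      (λ n p → begin
        q ℚ.* seq x n                    ≤⟨ ℚₚ.*-monoˡ-≤-nonNeg q {{ℚ.nonNegative 0≤q}} p ⟩
        q ℚ.* (seq y n ℚ.+ σ)            ≡⟨ distrib q (seq y n) σ ⟩
        q ℚ.* seq y n ℚ.+ σ ℚ.* q        ≤⟨ ℚₚ.+-monoʳ-≤ (q ℚ.* seq y n) σq≤δ ⟩
        q ℚ.* seq y n ℚ.+ δ              ∎)
      (eventually≤ h σ 0<σ)
    where
    distrib : ∀ q y s → q ℚ.* (y ℚ.+ s) ≡ q ℚ.* y ℚ.+ s ℚ.* q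
    distrib = solve 3 (λ q y s → q :* (y :+ s) := q :* y :+ s :* q) refl
      where open +-*-Solver

  -- A single approximation of `x` may be negative, so the product is not monotone termwise. What is
  -- nonnegative is `(q - e)(x + σ)`, and the excess `σ(q - e)` is at most `2qσ`, which `σ` is
  -- chosen to keep below `δ`.
  bounded-*ℝ-≤ : ∀ {q e x} → Eventually (λ n → ℚ.∣ seq e n ∣ ℚ.≤ q) → 0ℝ ≤ℝ x →
                 e *ℝ x ≤ℝ fromℚ q *ℝ x
  bounded-*ℝ-≤ {q} {e} {x} he 0≤x = mk≤ λ δ 0<δ →
    let _ , ∣e∣≤q        = eventually-witness he
        0≤q              = ℚₚ.≤-trans (ℚₚ.0≤∣p∣ _) ∣e∣≤q
        0≤q+q            = ℚₚ.≤-trans 0≤q (ℚₚ.≤-trans (ℚₚ.≤-reflexive (sym (ℚₚ.+-identityʳ q))) (ℚₚ.+-monoʳ-≤ q 0≤q))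
        σ , 0<σ , σ2q≤δ  = CauchyLemmas.shrink (q ℚ.+ q) 0≤q+q 0<δ
    in eventually-zip (λ n b p → estimate σ2q≤δ (ℚₚ.<⇒≤ 0<σ) b p) he (eventually≤ 0≤x σ 0<σ)
    where
    distrib : ∀ q e x s → e ℚ.* x ℚ.+ (q ℚ.- e) ℚ.* (x ℚ.+ s) ≡ q ℚ.* x ℚ.+ s ℚ.* (q ℚ.- e)
    distrib = solve 4 (λ q e x s → e :* x :+ (q :- e) :* (x :+ s) := q :* x :+ s :* (q :- e)) refl
      where open +-*-Solver
    estimate : ∀ {e x σ δ} → σ ℚ.* (q ℚ.+ q) ℚ.≤ δ → 0ℚ ℚ.≤ σ → ℚ.∣ e ∣ ℚ.≤ q → 0ℚ ℚ.≤ x ℚ.+ σ →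
               e ℚ.* x ℚ.≤ q ℚ.* x ℚ.+ δ
    estimate {e} {x} {σ} {δ} hσ 0≤σ b 0≤x+σ = begin
      e ℚ.* x                                   ≡⟨ sym (ℚₚ.+-identityʳ (e ℚ.* x)) ⟩
      e ℚ.* x ℚ.+ 0ℚ                            ≤⟨ ℚₚ.+-monoʳ-≤ (e ℚ.* x) (0≤* 0≤q-e 0≤x+σ) ⟩
      e ℚ.* x ℚ.+ (q ℚ.- e) ℚ.* (x ℚ.+ σ)       ≡⟨ distrib q e x σ ⟩
      q ℚ.* x ℚ.+ σ ℚ.* (q ℚ.- e)               ≤⟨ ℚₚ.+-monoʳ-≤ (q ℚ.* x)
           (ℚₚ.*-monoˡ-≤-nonNeg σ {{ℚ.nonNegative 0≤σ}} (ℚₚ.+-monoʳ-≤ q -e≤q)) ⟩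
      q ℚ.* x ℚ.+ σ ℚ.* (q ℚ.+ q)               ≤⟨ ℚₚ.+-monoʳ-≤ (q ℚ.* x) hσ ⟩
      q ℚ.* x ℚ.+ δ                             ∎
      where
      -e≤q : ℚ.- e ℚ.≤ q
      -e≤q = ℚₚ.≤-trans (p≤∣p∣ (ℚ.- e)) (ℚₚ.≤-trans (ℚₚ.≤-reflexive (ℚₚ.∣-p∣≡∣p∣ e)) b)
      0≤q-e : 0ℚ ℚ.≤ q ℚ.- e
      0≤q-e = ℚₚ.≤-trans (ℚₚ.≤-reflexive (sym (ℚₚ.+-inverseʳ e)))
        (ℚₚ.+-monoˡ-≤ (ℚ.- e) (ℚₚ.≤-trans (p≤∣p∣ e) b))

  ≤ℝ+δ⇒≤ℝ : ∀ {x y} → (∀ δ → 0ℚ ℚ.< δ → x ≤ℝ y +ℝ fromℚ δ) → x ≤ℝ y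
  ≤ℝ+δ⇒≤ℝ {x} {y} h = mk≤ λ δ 0<δ → eventually-map
    (λ n p → begin
      seq x n                              ≤⟨ p ⟩
      seq y n ℚ.+ ½* δ ℚ.+ ½* δ            ≡⟨ ℚₚ.+-assoc (seq y n) (½* δ) (½* δ) ⟩
      seq y n ℚ.+ (½* δ ℚ.+ ½* δ)          ≡⟨ cong (seq y n ℚ.+_) (½+½ δ) ⟩
      seq y n ℚ.+ δ                        ∎)
    (eventually≤ (h (½* δ) (0<½* 0<δ)) (½* δ) (0<½* 0<δ))

  -- Classically trivial; here the comparison is decided on rational
  -- approximations taken at an index where both sequences have settled.
  ≮ℝ⇒≥ℝ : ∀ {x y} → ¬ (y <ℝ x) → x ≤ℝ y
  ≮ℝ⇒≥ℝ {x} {y} y≮x = mk≤ λ δ 0<δ →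
    let N , hN = cauchy x (η δ) (0<½* (0<½* (0<½* 0<δ)))
        M , hM = cauchy y (η δ) (0<½* (0<½* (0<½* 0<δ)))
        K      = N ℕ.⊔ M
    in decide 0<δ K
         (λ n hn → hN n K (ℕₚ.m⊔n≤o⇒m≤o N M hn) (ℕₚ.m≤m⊔n N M))
         (λ n hn → hN K n (ℕₚ.m≤m⊔n N M) (ℕₚ.m⊔n≤o⇒m≤o N M hn))
         (λ n hn → hM n K (ℕₚ.m⊔n≤o⇒n≤o N M hn) (ℕₚ.m≤n⊔m N M))
         (λ n hn → hM K n (ℕₚ.m≤n⊔m N M) (ℕₚ.m⊔n≤o⇒n≤o N M hn))
    where
    -- The sequences are compared at index `K` with threshold `3δ/4`, and each drifts by at most
    -- `δ/8` afterwards. The total drift `δ/4` turns one outcome into `x ≤ y + δ` and the other into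
    -- `y + δ/2 ≤ x`.
    η θ : ℚ → ℚ
    η δ = ½* (½* (½* δ))
    θ δ = ½* δ ℚ.+ ½* (½* δ)
    below : ∀ {a b c d δ} → ℚ.∣ a ℚ.- b ∣ ℚ.≤ η δ → ℚ.∣ c ℚ.- d ∣ ℚ.≤ η δ →
            b ℚ.≤ c ℚ.+ θ δ → a ℚ.≤ d ℚ.+ δ
    below {a} {b} {c} {d} {δ} ab cd b≤c = begin
      a                                 ≤⟨ p≤q+∣p-q∣ a b ⟩
      b ℚ.+ ℚ.∣ a ℚ.- b ∣               ≤⟨ ℚₚ.+-mono-≤ b≤c ab ⟩
      (c ℚ.+ θ δ) ℚ.+ η δ               ≤⟨ ℚₚ.+-monoˡ-≤ (η δ) (ℚₚ.+-monoˡ-≤ (θ δ)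
                                             (ℚₚ.≤-trans (p≤q+∣p-q∣ c d) (ℚₚ.+-monoʳ-≤ d cd))) ⟩
      ((d ℚ.+ η δ) ℚ.+ θ δ) ℚ.+ η δ     ≡⟨ regroup d δ ⟩
      d ℚ.+ δ                           ∎
      where
      regroup : ∀ d δ → ((d ℚ.+ η δ) ℚ.+ θ δ) ℚ.+ η δ ≡ d ℚ.+ δ
      regroup = solve 2 (λ d δ →
        let h = con ℚ.½ :* δ ; q = con ℚ.½ :* h ; e = con ℚ.½ :* q in
        ((d :+ e) :+ (h :+ q)) :+ e := d :+ δ) refl
        where open +-*-Solver
    above : ∀ {a b c d δ} → ℚ.∣ b ℚ.- a ∣ ℚ.≤ η δ → ℚ.∣ c ℚ.- d ∣ ℚ.≤ η δ →
            a ℚ.+ θ δ ℚ.≤ c → b ℚ.+ ½* δ ℚ.≤ d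
    above {a} {b} {c} {d} {δ} ba cd a≤c = begin
      b ℚ.+ ½* δ                        ≤⟨ ℚₚ.+-monoˡ-≤ (½* δ) (ℚₚ.≤-trans (p≤q+∣p-q∣ b a) (ℚₚ.+-monoʳ-≤ a ba)) ⟩
      (a ℚ.+ η δ) ℚ.+ ½* δ              ≡⟨ regroup a δ ⟩
      (a ℚ.+ θ δ) ℚ.- η δ               ≤⟨ ℚₚ.+-monoˡ-≤ (ℚ.- η δ) a≤c ⟩
      c ℚ.- η δ                         ≤⟨ p-q≤r (ℚₚ.≤-trans (p≤q+∣p-q∣ c d)
                                             (ℚₚ.≤-trans (ℚₚ.+-monoʳ-≤ d cd) (ℚₚ.≤-reflexive (ℚₚ.+-comm d (η δ))))) ⟩
      d                                 ∎
      where
      regroup : ∀ a δ → (a ℚ.+ η δ) ℚ.+ ½* δ ≡ (a ℚ.+ θ δ) ℚ.- η δ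
      regroup = solve 2 (λ a δ →
        let h = con ℚ.½ :* δ ; q = con ℚ.½ :* h ; e = con ℚ.½ :* q in
        (a :+ e) :+ h := (a :+ (h :+ q)) :- e) refl
        where open +-*-Solver
    decide : ∀ {δ} → 0ℚ ℚ.< δ → ∀ K →
             (∀ n → K ≤ n → ℚ.∣ seq x n ℚ.- seq x K ∣ ℚ.≤ η δ) →
             (∀ n → K ≤ n → ℚ.∣ seq x K ℚ.- seq x n ∣ ℚ.≤ η δ) →
             (∀ n → K ≤ n → ℚ.∣ seq y n ℚ.- seq y K ∣ ℚ.≤ η δ) →
             (∀ n → K ≤ n → ℚ.∣ seq y K ℚ.- seq y n ∣ ℚ.≤ η δ) →
             Eventually (λ n → seq x n ℚ.≤ seq y n ℚ.+ δ)
    decide {δ} 0<δ K xK Kx yK Ky with ℚₚ.≤-total (seq x K) (seq y K ℚ.+ θ δ)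
    ... | inj₁ l = K , λ n hn → below {seq x n} {seq x K} {seq y K} {seq y n} {δ} (xK n hn) (Ky n hn) l
    ... | inj₂ l = contradiction
      (½* δ , 0<½* 0<δ , K , λ n hn → above {seq y K} {seq y n} {seq x K} {seq x n} {δ} (yK n hn) (Kx n hn) l) y≮x

  -- Stands in for division by a positive real: the success probability enters the counting through
  -- a natural number that is at least its reciprocal.
  archimedean-inverse : ∀ {x} → 0ℝ <ℝ x → ∃[ m ] 1ℝ ≤ℝ fromℕ m *ℝ x
  archimedean-inverse {x} (δ , 0<δ , h) =
    let m , hm = archimedean-* 1ℚ 0<δ in
    m , pointwise≤⇒≤ℝ {1ℝ} {fromℕ m *ℝ x} (eventually-map
      (λ n p → ℚₚ.≤-trans hm (ℚₚ.*-monoˡ-≤-nonNeg (ι m)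
        (ℚₚ.≤-trans (ℚₚ.≤-reflexive (sym (ℚₚ.+-identityˡ δ))) p))) h)

  fromℕ-cancel-≤ : ∀ {m n} → fromℕ m ≤ℝ fromℕ n → m ≤ n
  fromℕ-cancel-≤ {m} {n} h with m ℕₚ.≤? n
  ... | yes m≤n = m≤n
  ... | no  m≰n =
    -- Any tolerance below 1, the gap between consecutive naturals, gives the contradiction.
    let _ , p = eventually-witness (eventually≤ h ℚ.½ (ℚₚ.positive⁻¹ ℚ.½)) in
    contradiction
      (begin-strict
        ι n ℚ.+ ℚ.½  <⟨ ℚₚ.+-monoʳ-< (ι n) ½<1 ⟩
        ι n ℚ.+ 1ℚ   ≡⟨ ℚₚ.+-comm (ι n) 1ℚ ⟩
        1ℚ ℚ.+ ι n   ≡⟨ sym (ι-suc n) ⟩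
        ι (suc n)    ≤⟨ ι-mono (ℕₚ.≰⇒> m≰n) ⟩
        ι m          ≤⟨ p ⟩
        ι n ℚ.+ ℚ.½  ∎)
      (ℚₚ.<-irrefl refl)
    where
    ½<1 : ℚ.½ ℚ.< 1ℚ
    ½<1 = ℚ.*<* (ℤ.+<+ (s≤s (s≤s ℕ.z≤n)))

  ∣expSum∣≤expSum : ∀ {q b} → 0ℚ ℚ.≤ b → ℚ.∣ q ∣ ℚ.≤ b → ∀ n → ℚ.∣ expSum q n ∣ ℚ.≤ expSum b n
  ∣expSum∣≤expSum 0≤b h zero = ℚₚ.≤-refl
  ∣expSum∣≤expSum {q} 0≤b h (suc n) = ℚₚ.≤-trans (ℚₚ.∣p+q∣≤∣p∣+∣q∣ (expSum q n) (expTerm q n))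
    (ℚₚ.+-mono-≤ (∣expSum∣≤expSum 0≤b h n) (ExpLemmas.∣term∣≤ 0≤b h n))

  -- One `B` serves every `x` in `(0, y]`, so constants built from it do not depend on the privacy
  -- parameter. The approximations of such an `x` are eventually nonnegative and at most `b + 1`, so
  -- their partial sums are dominated by those at `b + 1`.
  exp-locally-bounded : ∀ y → ∃[ B ] (∀ x → 0ℝ <ℝ x → x ≤ℝ y →
                        Eventually (λ n → ℚ.∣ seq (exp x) n ∣ ℚ.≤ ι B))
  exp-locally-bounded y =
    let b , hb = CauchyLemmas.bounded {seq y} (cauchy y)
        -- The `suc` pays for using `x ≤ℝ y` with tolerance 1.
        B , hB = CauchyLemmas.bounded {seq (exp (fromℕ (suc b)))} (cauchy (exp (fromℕ (suc b))))
    in B , λ x 0<x x≤y → eventually-zip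
         (λ n small p → ℚₚ.≤-trans (∣expSum∣≤expSum (0≤ι (suc b)) small n) (ℚₚ.≤-trans (p≤∣p∣ _) p))
         (eventually-zip (λ n p x≤ → ℚₚ.≤-trans (ℚₚ.≤-reflexive (ℚₚ.0≤p⇒∣p∣≡p p)) x≤)
           (nonneg {x} 0<x)
           (eventually-zip
             (λ n y≤b x≤y+1 → begin
               seq x n            ≤⟨ x≤y+1 ⟩
               seq y n ℚ.+ 1ℚ     ≤⟨ ℚₚ.+-monoˡ-≤ 1ℚ (ℚₚ.≤-trans (p≤∣p∣ (seq y n)) y≤b) ⟩
               ι b ℚ.+ 1ℚ         ≡⟨ ℚₚ.+-comm (ι b) 1ℚ ⟩
               1ℚ ℚ.+ ι b         ≡⟨ sym (ι-suc b) ⟩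
               ι (suc b)          ∎)
             hb (eventually≤ x≤y 1ℚ 0<1ℚ)))
         hB
    where
    nonneg : ∀ {x} → 0ℝ <ℝ x → Eventually (λ n → 0ℚ ℚ.≤ seq x n)
    nonneg (δ , 0<δ , h) = eventually-map (λ n p → ℚₚ.≤-trans (+δ-nonneg 0ℚ 0<δ) p) h

  -- The triangle inequality in the form `y - α ≤ x ≤ z + α`. It is what separates the sets of
  -- accurate outputs.
  overlap⇒≤2α : ∀ {α x y z} → ∣ x -ℝ y ∣ℝ ≤ℝ α → ∣ x -ℝ z ∣ℝ ≤ℝ α → y ≤ℝ z +ℝ (α +ℝ α)
  overlap⇒≤2α {α} {x} {y} {z} hy hz =
    mk≤ λ δ 0<δ → eventually-map
      (λ n p → begin
        seq y n                                            ≡⟨ expand (seq y n) (seq α n) ⟩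
        (seq y n ℚ.- seq α n) ℚ.+ seq α n                  ≤⟨ ℚₚ.+-monoˡ-≤ (seq α n) p ⟩
        ((seq z n ℚ.+ seq α n) ℚ.+ δ) ℚ.+ seq α n          ≡⟨ regroup (seq z n) (seq α n) δ ⟩
        (seq z n ℚ.+ (seq α n ℚ.+ seq α n)) ℚ.+ δ          ∎)
      (eventually≤ (≤ℝ-trans {y -ℝ α} {x} {z +ℝ α}
        (WithinLemmas.within⇒lower {α} {y} {x} hy) (WithinLemmas.within⇒upper {α} {z} {x} hz)) δ 0<δ)
    where
    expand : ∀ y a → y ≡ (y ℚ.- a) ℚ.+ a
    expand = solve 2 (λ y a → y := (y :- a) :+ a) refl
      where open +-*-Solver
    regroup : ∀ z a δ → ((z ℚ.+ a) ℚ.+ δ) ℚ.+ a ≡ (z ℚ.+ (a ℚ.+ a)) ℚ.+ δ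
    regroup = solve 3 (λ z a δ → ((z :+ a) :+ δ) :+ a := (z :+ (a :+ a)) :+ δ) refl
      where open +-*-Solver

-- Packing disjoint events into a probability space

-- Countable additivity concerns families indexed by `ℕ`. The padding sets are empty, so
-- disjointness survives.
extend : ∀ {T m} → (Fin m → Pred (Output T) 0ℓ) → ℕ → Pred (Output T) 0ℓ
extend {m = zero}  S n       = ∁ U
extend {m = suc m} S zero    = S zero
extend {m = suc m} S (suc n) = extend (S ∘ suc) n

extend-borel : ∀ {T m} {S : Fin m → Pred (Output T) 0ℓ} → (∀ i → Borel (S i)) → ∀ n → Borel (extend S n)
extend-borel {m = zero}  b n       = complement whole
extend-borel {m = suc m} b zero    = b zero
extend-borel {m = suc m} b (suc n) = extend-borel (b ∘ suc) n

extend-index : ∀ {T m} (S : Fin m → Pred (Output T) 0ℓ) {n y} → extend S n y → ∃[ i ] toℕ i ≡ n × S i y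
extend-index {m = zero}  S         h = contradiction _ h
extend-index {m = suc m} S {zero}  h = zero , refl , h
extend-index {m = suc m} S {suc n} h with i , eq , h′ ← extend-index (S ∘ suc) {n} h = suc i , cong suc eq , h′

-- The property ranges over Borel derivations because `Pr` takes the derivation as an argument.
extend-< : ∀ {T m} {S : Fin m → Pred (Output T) 0ℓ} (b : ∀ i → Borel (S i))
           (P : ∀ {S} → Borel S → Set) → (∀ i → P (b i)) → ∀ n → n ℕ.< m → P (extend-borel b n)
extend-< {m = suc m} b P h zero    _   = h zero
extend-< {m = suc m} b P h (suc n) n<m = extend-< (b ∘ suc) P (h ∘ suc) n (s≤s⁻¹ n<m)

module _ {x : ℕ → ℝ} (0≤x : ∀ n → 0ℝ ≤ℝ x n) where

  partialSum-mono : ∀ j n → partialSum x n ≤ℝ partialSum x (j ℕ.+ n)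
  partialSum-mono zero    n = ≤ℝ-refl {partialSum x n}
  partialSum-mono (suc j) n = ≤ℝ-trans {partialSum x n} {partialSum x (j ℕ.+ n)} {partialSum x (suc j ℕ.+ n)}
    (partialSum-mono j n) (x≤x+y {partialSum x (j ℕ.+ n)} {x (j ℕ.+ n)} (0≤x (j ℕ.+ n)))

  -- Nonnegative terms make the partial sums nondecreasing, and late ones exceed the limit by at
  -- most `δ`. This extracts a bound on finite sums of probabilities from countable additivity.
  partialSum≤limit : ∀ {l} → partialSum x ⟶ l → ∀ n → partialSum x n ≤ℝ l
  partialSum≤limit {l} conv n = ≤ℝ+δ⇒≤ℝ {partialSum x n} {l} λ δ 0<δ →
    let N , hN = conv δ 0<δ in
    ≤ℝ-trans {partialSum x n} {partialSum x (N ℕ.+ n)} {l +ℝ fromℚ δ} (partialSum-mono N n)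
      (WithinLemmas.within⇒upper {fromℚ δ} {l} {partialSum x (N ℕ.+ n)} (hN (N ℕ.+ n) (ℕₚ.m≤m+n N n)))

count≤*partialSum : ∀ C {x : ℕ → ℝ} n → (∀ i → i ℕ.< n → 1ℝ ≤ℝ fromℕ C *ℝ x i) →
                    fromℕ n ≤ℝ fromℕ C *ℝ partialSum x n
count≤*partialSum C {x} zero    h = pointwise≡⇒≤ℝ {fromℕ 0} {fromℕ C *ℝ partialSum x 0}
  (λ _ → sym (ℚₚ.*-zeroʳ (ι C)))
count≤*partialSum C {x} (suc n) h =
  ≤ℝ-trans {fromℕ (suc n)} {fromℕ n +ℝ 1ℝ} {fromℕ C *ℝ partialSum x (suc n)}
    (pointwise≡⇒≤ℝ {fromℕ (suc n)} {fromℕ n +ℝ 1ℝ} (λ _ → trans (ι-suc n) (ℚₚ.+-comm 1ℚ (ι n))))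
    (≤ℝ-trans {fromℕ n +ℝ 1ℝ} {fromℕ C *ℝ partialSum x n +ℝ fromℕ C *ℝ x n} {fromℕ C *ℝ partialSum x (suc n)}
      (+ℝ-mono-≤ {fromℕ n} {fromℕ C *ℝ partialSum x n} {1ℝ} {fromℕ C *ℝ x n}
        (count≤*partialSum C n (λ i i<n → h i (ℕₚ.m≤n⇒m≤1+n i<n))) (h n ℕₚ.≤-refl))
      (pointwise≡⇒≤ℝ {fromℕ C *ℝ partialSum x n +ℝ fromℕ C *ℝ x n} {fromℕ C *ℝ partialSum x (suc n)}
        (λ j → sym (ℚₚ.*-distribˡ-+ (ι C) (seq (partialSum x n) j) (seq (x n) j)))))

module _ {T} (μ : ProbabilityMeasure T) where

  Pr≤1 : ∀ {S} (b : Borel S) → Pr μ S b ≤ℝ 1ℝ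
  Pr≤1 {S} b = ≤ℝ-trans {Pr μ S b} {Pr μ S b +ℝ Pr μ (∁ S) (complement b)} {1ℝ}
    (x≤x+y {Pr μ S b} {Pr μ (∁ S) (complement b)} (Pr-nonNeg μ (complement b)))
    (proj₁ (Pr-complement μ b))

  -- Disjoint sets have total probability at most 1, while each one has at least `1/C`. The
  -- multiplicative form of the hypothesis keeps the count free of division.
  packing : ∀ {m} {S : Fin m → Pred (Output T) 0ℓ} (b : ∀ i → Borel (S i)) →
            (∀ {i j y} → S i y → S j y → i ≡ j) →
            ∀ C → (∀ i → 1ℝ ≤ℝ fromℕ C *ℝ Pr μ (S i) (b i)) → m ≤ C
  packing {m} {S} b disjoint C h = fromℕ-cancel-≤
    (≤ℝ-trans {fromℕ m} {fromℕ C *ℝ partialSum x m} {fromℕ C}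
      (count≤*partialSum C m (extend-< b (λ {S} b → 1ℝ ≤ℝ fromℕ C *ℝ Pr μ S b) h))
      (≤ℝ-trans {fromℕ C *ℝ partialSum x m} {fromℕ C *ℝ 1ℝ} {fromℕ C}
        (fromℚ-*ℝ-mono-≤ {ι C} {partialSum x m} {1ℝ} (0≤ι C) sum≤1)
        (pointwise≡⇒≤ℝ {fromℕ C *ℝ 1ℝ} {fromℕ C} (λ _ → ℚₚ.*-identityʳ (ι C)))))
    where
    x : ℕ → ℝ
    x n = Pr μ (extend S n) (extend-borel b n)
    extend-disjoint : ∀ {i j y} → extend S i y → extend S j y → i ≡ j
    extend-disjoint {i} {j} hi hj with extend-index S {i} hi | extend-index S {j} hj
    ... | i′ , eq , hi′ | j′ , eq′ , hj′ = trans (sym eq) (trans (cong toℕ (disjoint hi′ hj′)) eq′)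
    sum≤1 : partialSum x m ≤ℝ 1ℝ
    sum≤1 = ≤ℝ-trans {partialSum x m} {Pr μ (⋃ ℕ (extend S)) (union (extend-borel b))} {1ℝ}
      (partialSum≤limit (λ n → Pr-nonNeg μ (extend-borel b n))
        {Pr μ (⋃ ℕ (extend S)) (union (extend-borel b))}
        (Pr-σ-additive μ (extend-borel b) (λ {i} {j} → extend-disjoint {i} {j})) m)
      (Pr≤1 (union (extend-borel b)))

fromℕ-*ℝ-assoc : ∀ m n x → fromℕ m *ℝ (fromℕ n *ℝ x) ≤ℝ fromℕ (m ℕ.* n) *ℝ x
fromℕ-*ℝ-assoc m n x = pointwise≡⇒≤ℝ {fromℕ m *ℝ (fromℕ n *ℝ x)} {fromℕ (m ℕ.* n) *ℝ x} λ j →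
  trans (sym (ℚₚ.*-assoc (ι m) (ι n) (seq x j))) (cong (ℚ._* seq x j) (sym (ι-* m n)))

-- Star graphs and bursts of insertions

∈⇒↭∷ : ∀ {A : Set} {x : A} {xs} → x ∈ xs → ∃[ ys ] xs ↭ x ∷ ys
∈⇒↭∷ {x = x} x∈xs with ys , zs , refl ← ∈-∃++ x∈xs = ys ++ zs , ↭ₚ.shift x ys zs

totalWeight-↭ : ∀ {es fs} → es ↭ fs → totalWeight es ≡ totalWeight fs
totalWeight-↭ = ListActionₚ.sum-↭ ∘ ↭ₚ.map⁺ weight

-- Each step cancels one occurrence in `fs`. Since `es` has no repetitions, its tail still lies in
-- what remains.
totalWeight-mono-⊆ : ∀ {es fs} → Unique es → es ⊆ fs → totalWeight es ≤ totalWeight fs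
totalWeight-mono-⊆ {[]}     _              _     = z≤n
totalWeight-mono-⊆ {e ∷ es} (e∉es ∷ es!) es⊆fs with fs′ , fs↭ ← ∈⇒↭∷ (es⊆fs (here refl)) =
  ℕₚ.≤-trans
    (ℕₚ.+-monoʳ-≤ (weight e) (totalWeight-mono-⊆ es!
      (⊆∷∧∉⇒⊆ (↭ₚ.∈-resp-↭ fs↭ ∘ es⊆fs ∘ there) (All¬⇒¬Any e∉es))))
    (ℕₚ.≤-reflexive (sym (totalWeight-↭ fs↭)))

∅ : Insertion
∅ = insertion [] []

burst : ∀ {T} → Fin T → Insertion → Fin T → Insertion
burst zero    δ zero    = δ
burst zero    δ (suc t) = ∅
burst (suc i) δ zero    = ∅
burst (suc i) δ (suc t) = burst i δ t

burst-at : ∀ {T} (i : Fin T) δ → burst i δ i ≡ δ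
burst-at zero    δ = refl
burst-at (suc i) δ = burst-at i δ

burst-off : ∀ {T} (i : Fin T) δ t → t ≢ i → burst i δ t ≡ ∅
burst-off zero    δ zero    t≢i = contradiction refl t≢i
burst-off zero    δ (suc t) t≢i = refl
burst-off (suc i) δ zero    t≢i = refl
burst-off (suc i) δ (suc t) t≢i = burst-off i δ t (t≢i ∘ cong suc)

-- Two bursts at the same time differ in a single step, so a relation between them reduces to the
-- idle pair and the burst pair, without case distinctions on `t` at each use.
burst-elim : (P : Insertion → Insertion → Set) → P ∅ ∅ → ∀ {δ δ′} → P δ δ′ →
             ∀ {T} (i t : Fin T) → P (burst i δ t) (burst i δ′ t)
burst-elim P p∅ p zero    zero    = p
burst-elim P p∅ p zero    (suc t) = p∅
burst-elim P p∅ p (suc i) zero    = p∅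
burst-elim P p∅ p (suc i) (suc t) = burst-elim P p∅ p i t

burst-∅ : ∀ {T} (i t : Fin T) → ∅ ≡ burst i ∅ t
burst-∅ i t = burst-elim (λ _ δ → ∅ ≡ δ) refl {∅} refl i t

-- Counts the leaves present after step `t`: unlike `burst`, it keeps its value after time `i`.
burst-size : ∀ {T} → Fin T → ℕ → Fin T → ℕ
burst-size zero    m t       = m
burst-size (suc i) m zero    = 0
burst-size (suc i) m (suc t) = burst-size i m t

idle-after : ∀ {T} G (t : Fin T) → graphAfter G (λ _ → ∅) t ≡ G
idle-after G zero    = refl
idle-after G (suc t) = idle-after G t

-- Nodes arrive only in step `i`, and all earlier steps are idle, so freshness need only be checked
-- against `G`.
burst-before : ∀ {T} (i : Fin T) G δ t {v} → v ∈ newNodes (burst i δ t) →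
               v ∈ newNodes δ × graphBefore G (burst i δ) t ≡ G
burst-before zero    G δ zero    v∈ = v∈ , refl
burst-before (suc i) G δ (suc t) v∈ = burst-before i G δ t v∈

burst-before-edges : ∀ {T} (i : Fin T) G δ t {e} → e ∈ newEdges (burst i δ t) →
                     graphBefore G (burst i δ) t ≡ G
burst-before-edges zero    G δ zero    e∈ = refl
burst-before-edges (suc i) G δ (suc t) e∈ = burst-before-edges i G δ t e∈

burst-size-at : ∀ {T} (i : Fin T) m → burst-size i m i ≡ m
burst-size-at zero    m = refl
burst-size-at (suc i) m = burst-size-at i m

burst-size-before : ∀ {T} (i t : Fin T) m → t Fin.< i → burst-size i m t ≡ 0
burst-size-before (suc i) zero    m t<i       = refl
burst-size-before (suc i) (suc t) m (s≤s t<i) = burst-size-before i t m t<i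

module Stars (W : ℕ) (1≤W : 1 ≤ W) where

  spoke : ℕ → Edge
  spoke j = edge 0 (suc j) W (s≤s z≤n)

  spokes : ℕ → List Edge
  spokes m = map spoke (downFrom m)

  -- Node 0 is the hub. `downFrom` puts the newest leaf first, so one more leaf adds one head to
  -- each list, and adjacency of consecutive levels becomes a fact about heads.
  leaves : ℕ → Insertion
  leaves m = insertion (map suc (downFrom m)) (spokes m)

  hub : Graph
  hub = graph (0 ∷ []) []

  star : ℕ → Graph
  star m = insert hub (leaves m)

  ∈-spokes⁻ : ∀ {m e} → e ∈ spokes m → ∃[ j ] j ℕ.< m × e ≡ spoke j
  ∈-spokes⁻ e∈ with j , j∈ , eq ← ∈-map⁻ spoke e∈ = j , ∈-downFrom⁻ j∈ , eq

  ∈-star⁻ : ∀ {m e} → e ∈ edges (star m) → e ∈ spokes m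
  ∈-star⁻ {m} e∈ with ∈-++⁻ (spokes m) e∈
  ... | inj₁ e∈′ = e∈′
  ... | inj₂ ()

  spokes-unique : ∀ m → Unique (spokes m)
  spokes-unique m = Unique.map⁺ {f = spoke} (ℕₚ.suc-injective ∘ cong hi) (Unique.downFrom⁺ m)

  totalWeight-spokes : ∀ m → totalWeight (spokes m) ≡ m ℕ.* W
  totalWeight-spokes zero    = refl
  totalWeight-spokes (suc m) = cong (W ℕ.+_) (totalWeight-spokes m)

  star-isGraph : ∀ m → IsGraph W (star m)
  star-isGraph m = record
    { endpoints = λ e∈ → endpoints (∈-spokes⁻ {m} (∈-star⁻ {m} e∈))
    ; simple    = λ e∈ e′∈ _ hi≡ → simple (∈-spokes⁻ {m} (∈-star⁻ {m} e∈)) (∈-spokes⁻ {m} (∈-star⁻ {m} e′∈)) hi≡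
    ; weights   = λ e∈ → weights (∈-spokes⁻ {m} (∈-star⁻ {m} e∈))
    }
    where
    endpoints : ∀ {e} → ∃[ j ] j ℕ.< m × e ≡ spoke j → lo e ∈ nodes (star m) × hi e ∈ nodes (star m)
    endpoints (j , j<m , refl) = ∈-++⁺ʳ (map suc (downFrom m)) (here refl) ,
      ∈-++⁺ˡ (∈-map⁺ suc (∈-downFrom⁺ j<m))
    simple : ∀ {e e′} → ∃[ j ] j ℕ.< m × e ≡ spoke j → ∃[ j ] j ℕ.< m × e′ ≡ spoke j → hi e ≡ hi e′ → e ≡ e′
    simple (_ , _ , refl) (_ , _ , refl) refl = refl
    weights : ∀ {e} → ∃[ j ] j ℕ.< m × e ≡ spoke j → 1 ≤ weight e × weight e ≤ W
    weights (_ , _ , refl) = 1≤W , ℕₚ.≤-refl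

  -- With `adjacent-leaf` this says that the star is bipartite, the hub forming one side.
  adjacent-hub : ∀ {m u v} → Adjacent (spokes m) u v → u ≢ 0 → v ≡ 0
  adjacent-hub (e , e∈ , h) u≢0 with ∈-spokes⁻ e∈
  adjacent-hub (e , e∈ , inj₁ (u≡0 , _)) u≢0 | _ , _ , refl = contradiction u≡0 u≢0
  adjacent-hub (e , e∈ , inj₂ (_ , v≡0)) u≢0 | _ , _ , refl = v≡0

  adjacent-leaf : ∀ {m u v} → Adjacent (spokes m) u v → u ≡ 0 → v ≢ 0
  adjacent-leaf (e , e∈ , h) u≡0 v≡0 with ∈-spokes⁻ e∈
  adjacent-leaf (e , e∈ , inj₁ (_ , refl)) u≡0 () | _ , _ , refl
  adjacent-leaf (e , e∈ , inj₂ (refl , _)) () v≡0 | _ , _ , refl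

  -- Every second vertex of a walk is the hub, so a closed walk of length at
  -- least three repeats it.
  spokes-acyclic : ∀ m v vs → ¬ IsCycle (spokes m) v vs
  spokes-acyclic m v vs c = go vs (IsCycle.distinct c) (IsCycle.long c) (IsCycle.closed c)
    where
    go : ∀ vs → Unique (v ∷ vs) → 3 ≤ length (v ∷ vs) → ¬ Linked (Adjacent (spokes m)) (v ∷ vs ∷ʳ v)
    go []           _ (s≤s ())
    go (_ ∷ [])     _ (s≤s (s≤s ()))
    go (x ∷ y ∷ zs) ((v≢x ∷ v≢y ∷ _) ∷ (x≢y ∷ x∉) ∷ _) _ (vx ∷ xy ∷ rest) with v ℕₚ.≟ 0
    ... | yes v≡0 = v≢y (trans v≡0 (sym (adjacent-hub {m} xy (adjacent-leaf {m} vx v≡0))))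
    ... | no  v≢0 = no-return zs x∉ rest
      where
      x≡0 : x ≡ 0
      x≡0 = adjacent-hub {m} vx v≢0
      y≢0 : y ≢ 0
      y≢0 = adjacent-leaf {m} xy x≡0
      no-return : ∀ zs → All (x ≢_) zs → ¬ Linked (Adjacent (spokes m)) (y ∷ zs ∷ʳ v)
      no-return []      _         (yv ∷ _) = v≢0 (adjacent-hub {m} yv y≢0)
      no-return (z ∷ _) (x≢z ∷ _) (yz ∷ _) = x≢z (trans x≡0 (sym (adjacent-hub {m} yz y≢0)))

  -- A walk in `F` from a leaf to the hub has to leave the leaf, and the only edge of the star at
  -- that leaf is its spoke.
  spanning⊇spokes : ∀ m {F} → IsSpanningForest (star m) F → spokes m ⊆ F
  spanning⊇spokes m {F} sf {e} e∈ with ∈-spokes⁻ {m} e∈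
  ... | j , _ , refl = leave (IsSpanningForest.spanning sf
    ((spoke j , ∈-++⁺ˡ e∈ , inj₂ (refl , refl)) ◅ Star.ε))
    where
    leave : Connected F (suc j) 0 → spoke j ∈ F
    leave ((f , f∈ , h) ◅ _) with ∈-spokes⁻ {m} (∈-star⁻ {m} (IsSpanningForest.subgraph sf f∈))
    leave ((f , f∈ , inj₁ (() , _)) ◅ _) | _ , _ , refl
    leave ((f , f∈ , inj₂ (refl , _)) ◅ _) | _ , _ , refl = f∈

  -- The spokes are contained in every spanning forest and form one themselves, so there is nothing
  -- to optimise.
  star-MSTWeight : ∀ m → IsMSTWeight (star m) (m ℕ.* W)
  star-MSTWeight m = record
    { attained = spokes m , forest , totalWeight-spokes m
    ; minimal  = λ F sf → ℕₚ.≤-trans (ℕₚ.≤-reflexive (sym (totalWeight-spokes m)))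
                   (totalWeight-mono-⊆ (spokes-unique m) (spanning⊇spokes m sf))
    }
    where
    forest : IsSpanningForest (star m) (spokes m)
    forest = record
      { unique   = spokes-unique m
      ; subgraph = ∈-++⁺ˡ
      ; acyclic  = spokes-acyclic m
      ; spanning = Star.map (λ (e , e∈ , h) → e , ∈-star⁻ {m} e∈ , h)
      }

  -- Burst inputs and the chain of node-adjacent levels

  burst-after : ∀ {T} (i : Fin T) m t → graphAfter hub (burst i (leaves m)) t ≡ star (burst-size i m t)
  burst-after zero    m zero    = refl
  burst-after zero    m (suc t) = idle-after (star m) t
  burst-after (suc i) m zero    = refl
  burst-after (suc i) m (suc t) = burst-after i m t

  idleSequence : ∀ T → IncrementalSequence W T
  idleSequence T = record
    { initial         = hub
    ; insertions      = λ _ → ∅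
    ; initial-isGraph = star-isGraph 0
    ; after-isGraph   = λ t → subst (IsGraph W) (sym (idle-after hub t)) (star-isGraph 0)
    ; ∂V-new          = λ t ()
    ; ∂E-new          = λ t ()
    }

  burstSequence : ∀ {T} → Fin T → ℕ → IncrementalSequence W T
  burstSequence i m = record
    { initial         = hub
    ; insertions      = burst i (leaves m)
    ; initial-isGraph = star-isGraph 0
    ; after-isGraph   = λ t → subst (IsGraph W) (sym (burst-after i m t)) (star-isGraph (burst-size i m t))
    ; ∂V-new          = ∂V-new′
    ; ∂E-new          = ∂E-new′
    }
    where
    ∂V-new′ : ∀ t {v} → v ∈ newNodes (burst i (leaves m) t) → v ∉ nodes (graphBefore hub (burst i (leaves m)) t)
    ∂V-new′ t v∈ v∈′ with burst-before i hub (leaves m) t v∈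
    ... | v∈leaves , eq with ∈-map⁻ suc v∈leaves | subst (λ G → _ ∈ nodes G) eq v∈′
    ...   | _ , _ , refl | here ()
    ∂E-new′ : ∀ t {e} → e ∈ newEdges (burst i (leaves m) t) → e ∉ edges (graphBefore hub (burst i (leaves m)) t)
    ∂E-new′ t e∈ e∈′ with subst (λ G → _ ∈ edges G) (burst-before-edges i hub (leaves m) t e∈) e∈′
    ... | ()

  -- Level 0 is one sequence shared by all i, whereas the sequences
  -- `burstSequence i 0` agree only extensionally, and `law` need not respect that.
  level : ∀ {T} → Fin T → ℕ → IncrementalSequence W T
  level i zero    = idleSequence _
  level i (suc m) = burstSequence i (suc m)

  insertions-level : ∀ {T} (i : Fin T) m t → insertions (level i m) t ≡ burst i (leaves m) t
  insertions-level i zero    t = burst-∅ i t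
  insertions-level i (suc m) t = refl

  initial-level : ∀ {T} (i : Fin T) m → initial (level i m) ≡ hub
  initial-level i zero    = refl
  initial-level i (suc m) = refl

  -- The omitted node is the newest leaf, and the only edge lost with it is `spoke m`; both are
  -- heads of their lists. Rewriting by `insertions-level` treats the idle level `m = 0` like the
  -- others.
  level-omits : ∀ {T} (i : Fin T) m → OmitsNode (level i (suc m)) (level i m)
  level-omits {T} i m = record
    { v*         = suc m
    ; t*         = i
    ; initial-≡  = subst (SameGraph hub) (sym (initial-level i m)) (mk⇔ id id , mk⇔ id id)
    ; ∂V-≢t*     = ∂V-≢t*
    ; ∂V-⊆       = ∂V-⊆
    ; ∂V-∖       = ∂V-∖
    ; ∂E-at-new  = λ t → burst-elim
        (λ δ _ → ∀ {e} → e ∈ newEdges δ → ∃[ v ] v ∈ newNodes δ × Incident v e)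
        (λ ()) {leaves (suc m)} {∅} (λ e∈ → at-new (∈-spokes⁻ {suc m} e∈)) i t
    ; ∂E-maximal = λ t e → subst
        (λ δ → e ∈ newEdges δ ⇔ (e ∈ ∂E (level i (suc m)) t × ¬ Incident (suc m) e))
        (sym (insertions-level i m t))
        (burst-elim
          (λ δ δ′ → e ∈ newEdges δ′ ⇔ (e ∈ newEdges δ × ¬ Incident (suc m) e))
          (mk⇔ (λ ()) (λ ()))
          {leaves (suc m)} {leaves m} (mk⇔ (λ e∈ → there e∈ , not-last e∈) not-last⁻¹) i t)
    }
    where
    ∂V-≢t* : ∀ t → t ≢ i → ∂V (level i (suc m)) t ∼[ set ] ∂V (level i m) t
    ∂V-≢t* t t≢i
      rewrite insertions-level i m t | burst-off i (leaves (suc m)) t t≢i | burst-off i (leaves m) t t≢i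
      = mk⇔ id id
    ∂V-⊆ : ∂V (level i m) i ⊆ ∂V (level i (suc m)) i
    ∂V-⊆ rewrite insertions-level i m i | burst-at i (leaves (suc m)) | burst-at i (leaves m) = there
    last∉ : suc m ∉ map suc (downFrom m)
    last∉ h with _ , j∈ , refl ← ∈-map⁻ suc h = ℕₚ.<-irrefl refl (∈-downFrom⁻ j∈)
    ∂V-∖ : ∀ v → (v ∈ ∂V (level i (suc m)) i × v ∉ ∂V (level i m) i) ⇔ v ≡ suc m
    ∂V-∖ v rewrite insertions-level i m i | burst-at i (leaves (suc m)) | burst-at i (leaves m) =
      mk⇔ (λ { (here v≡ , _) → v≡ ; (there v∈ , v∉) → contradiction v∈ v∉ })
          (λ { refl → here refl , last∉ })
    at-new : ∀ {e} → ∃[ j ] j ℕ.< suc m × e ≡ spoke j →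
             ∃[ v ] v ∈ newNodes (leaves (suc m)) × Incident v e
    at-new (j , j<m , refl) = suc j , ∈-map⁺ suc (∈-downFrom⁺ j<m) , inj₂ refl
    not-last : ∀ {e} → e ∈ spokes m → ¬ Incident (suc m) e
    not-last e∈ inc with ∈-spokes⁻ {m} e∈
    not-last e∈ (inj₁ ())   | _ , _   , refl
    not-last e∈ (inj₂ refl) | _ , j<m , refl = ℕₚ.<-irrefl refl j<m
    not-last⁻¹ : ∀ {e} → e ∈ spokes (suc m) × ¬ Incident (suc m) e → e ∈ spokes m
    not-last⁻¹ (here refl , ¬inc) = contradiction (inj₂ refl) ¬inc
    not-last⁻¹ (there e∈  , _)    = e∈

  burst-MSTWeight : ∀ {T} (i : Fin T) m t →
                    IsMSTWeight (after (burstSequence i m) t) (burst-size i m t ℕ.* W)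
  burst-MSTWeight i m t = subst (λ G → IsMSTWeight G (burst-size i m t ℕ.* W))
    (sym (burst-after i m t)) (star-MSTWeight (burst-size i m t))

-- The lower bound

n≤2^n : ∀ n → n ≤ 2 ℕ.^ n
n≤2^n zero    = z≤n
n≤2^n (suc n) = begin
  suc n                        ≤⟨ ℕₚ.+-mono-≤ (ℕₚ.m^n>0 2 n) (n≤2^n n) ⟩
  2 ℕ.^ n ℕ.+ 2 ℕ.^ n          ≡⟨ cong (2 ℕ.^ n ℕ.+_) (sym (ℕₚ.+-identityʳ (2 ℕ.^ n))) ⟩
  2 ℕ.^ suc n                  ∎
  where open ℕₚ.≤-Reasoning

m≤[1+m/n]*n : ∀ m n .{{_ : ℕ.NonZero n}} → m ≤ suc (m ℕ./ n) ℕ.* n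
m≤[1+m/n]*n m n = begin
  m                                ≡⟨ m≡m%n+[m/n]*n m n ⟩
  m ℕ.% n ℕ.+ (m ℕ./ n) ℕ.* n      ≤⟨ ℕₚ.+-monoˡ-≤ _ (ℕₚ.<⇒≤ (m%n<n m n)) ⟩
  n ℕ.+ (m ℕ./ n) ℕ.* n            ∎
  where open ℕₚ.≤-Reasoning

module LowerBound {T W} (1≤W : 1 ≤ W) (A : Algorithm W T) {ε α : ℝ} (private-A : NodePrivate ε A) where
  open Stars W 1≤W

  reference : ProbabilityMeasure T
  reference = law A (idleSequence T)

  -- Descends the levels one leaf at a time, each removal costing a factor `exp ε`, bounded by `B`.
  -- The chain ends at the idle input, so the sets for all `i` are measured by one law.
  group-privacy : ∀ {B} → Eventually (λ n → ℚ.∣ seq (exp ε) n ∣ ℚ.≤ ι B) → ∀ i m {S} (b : Borel S) →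
                  Pr (law A (level i m)) S b ≤ℝ fromℕ (B ℕ.^ m) *ℝ Pr reference S b
  group-privacy {B} hB i zero    {S} b = pointwise≡⇒≤ℝ {Pr reference S b} {fromℕ 1 *ℝ Pr reference S b}
    (λ n → sym (ℚₚ.*-identityˡ (seq (Pr reference S b) n)))
  group-privacy {B} hB i (suc m) {S} b =
    ≤ℝ-trans {P (suc m)} {exp ε *ℝ P m} {fromℕ (B ℕ.^ suc m) *ℝ R}
      (private-A (level i (suc m)) (level i m) (inj₁ (level-omits i m)) b)
    (≤ℝ-trans {exp ε *ℝ P m} {fromℕ B *ℝ P m} {fromℕ (B ℕ.^ suc m) *ℝ R}
      (bounded-*ℝ-≤ {ι B} {exp ε} {P m} hB (Pr-nonNeg (law A (level i m)) b))
    (≤ℝ-trans {fromℕ B *ℝ P m} {fromℕ B *ℝ (fromℕ (B ℕ.^ m) *ℝ R)} {fromℕ (B ℕ.^ suc m) *ℝ R}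
      (fromℚ-*ℝ-mono-≤ {ι B} {P m} {fromℕ (B ℕ.^ m) *ℝ R} (0≤ι B) (group-privacy {B} hB i m b))
      (fromℕ-*ℝ-assoc B (B ℕ.^ m) R)))
    where
    P : ℕ → ℝ
    P m = Pr (law A (level i m)) S b
    R : ℝ
    R = Pr reference S b

  module _ (k : ℕ) where

    -- The number of leaves is a successor so that `level i (suc k)` is the burst sequence by
    -- computation.
    weightsAfter : Fin T → Fin T → ℕ
    weightsAfter i t = burst-size i (suc k) t ℕ.* W

    accurate : Fin T → Output T → Set
    accurate i = Within α (weightsAfter i)

    -- At time `i`, the earlier one, the first input already has the full star while the second
    -- still has weight 0. A single output would have to be close to both.
    accurate-overlap : ∀ {i j y} → i Fin.< j → accurate i y → accurate j y →
                       fromℕ (suc k ℕ.* W) ≤ℝ α +ℝ α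
    accurate-overlap {i} {j} {y} i<j hi hj =
      ≤ℝ-trans {fromℕ (suc k ℕ.* W)} {fromℕ 0 +ℝ (α +ℝ α)} {α +ℝ α}
        (overlap⇒≤2α {α} {y i} {fromℕ (suc k ℕ.* W)} {fromℕ 0}
          (subst (λ n → ∣ y i -ℝ fromℕ (n ℕ.* W) ∣ℝ ≤ℝ α) (burst-size-at i (suc k)) (hi i))
          (subst (λ n → ∣ y i -ℝ fromℕ (n ℕ.* W) ∣ℝ ≤ℝ α) (burst-size-before j i (suc k) i<j) (hj i)))
        (pointwise≡⇒≤ℝ {fromℕ 0 +ℝ (α +ℝ α)} {α +ℝ α} (λ n → ℚₚ.+-identityˡ _))

    accurate-disjoint : ¬ (fromℕ (suc k ℕ.* W) ≤ℝ α +ℝ α) →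
                        ∀ {i j y} → accurate i y → accurate j y → i ≡ j
    accurate-disjoint small {i} {j} {y} hi hj with Finₚ.<-cmp i j
    ... | tri< i<j _ _ = contradiction (accurate-overlap {y = y} i<j hi hj) small
    ... | tri≈ _ i≡j _ = i≡j
    ... | tri> _ _ j<i = contradiction (accurate-overlap {y = y} j<i hj hi) small

    -- Accuracy gives the set for `i` probability at least `p` on its own input, and group privacy
    -- transfers this to the reference law. There each set has probability at least the reciprocal
    -- of `M * B ^ suc k`, and `packing` applies.
    length-bound : ∀ {p M B} → HasAdditiveError A p α → 1ℝ ≤ℝ fromℕ M *ℝ p →
                   Eventually (λ n → ℚ.∣ seq (exp ε) n ∣ ℚ.≤ ι B) →
                   ¬ (fromℕ (suc k ℕ.* W) ≤ℝ α +ℝ α) → T ≤ M ℕ.* B ℕ.^ suc k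
    length-bound {p} {M} {B} acc 1≤Mp hB small =
      packing reference borel (λ {i} {j} {y} → accurate-disjoint small {i} {j} {y}) (M ℕ.* B ℕ.^ suc k) λ i →
        ≤ℝ-trans {1ℝ} {fromℕ M *ℝ p} {fromℕ (M ℕ.* B ℕ.^ suc k) *ℝ R i} 1≤Mp
        (≤ℝ-trans {fromℕ M *ℝ p} {fromℕ M *ℝ (fromℕ (B ℕ.^ suc k) *ℝ R i)} {fromℕ (M ℕ.* B ℕ.^ suc k) *ℝ R i}
          (fromℚ-*ℝ-mono-≤ {ι M} {p} {fromℕ (B ℕ.^ suc k) *ℝ R i} (0≤ι M)
            (≤ℝ-trans {p} {Pr (law A (burstSequence i (suc k))) (accurate i) (borel i)} {fromℕ (B ℕ.^ suc k) *ℝ R i}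
              (acc (burstSequence i (suc k)) (weightsAfter i) (burst-MSTWeight i (suc k)))
              (group-privacy {B} hB i (suc k) (borel i))))
          (fromℕ-*ℝ-assoc M (B ℕ.^ suc k) (R i)))
      where
      borel : ∀ i → Borel (accurate i)
      borel i = within-borel α (weightsAfter i)
      R : Fin T → ℝ
      R i = Pr reference (accurate i) (borel i)

-- Logarithms and the choice of constants

log≤⇒≤ : ∀ {T a b M B} k → M ≤ 2 ℕ.^ a → B ≤ 2 ℕ.^ b → T ≤ M ℕ.* B ℕ.^ k → ⌊log₂ T ⌋ ≤ a ℕ.+ b ℕ.* k
log≤⇒≤ {T} {a} {b} {M} {B} k M≤ B≤ T≤ = begin
  ⌊log₂ T ⌋                        ≤⟨ ⌊log₂⌋-mono-≤ (begin
    T                                ≤⟨ T≤ ⟩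
    M ℕ.* B ℕ.^ k                    ≤⟨ ℕₚ.*-mono-≤ M≤ (ℕₚ.^-monoˡ-≤ k B≤) ⟩
    2 ℕ.^ a ℕ.* (2 ℕ.^ b) ℕ.^ k      ≡⟨ cong (2 ℕ.^ a ℕ.*_) (ℕₚ.^-*-assoc 2 b k) ⟩
    2 ℕ.^ a ℕ.* 2 ℕ.^ (b ℕ.* k)      ≡⟨ sym (ℕₚ.^-distribˡ-+-* 2 a (b ℕ.* k)) ⟩
    2 ℕ.^ (a ℕ.+ b ℕ.* k)            ∎) ⟩
  ⌊log₂ 2 ℕ.^ (a ℕ.+ b ℕ.* k) ⌋    ≡⟨ ⌊log₂[2^n]⌋≡n (a ℕ.+ b ℕ.* k) ⟩
  a ℕ.+ b ℕ.* k                    ∎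
  where open ℕₚ.≤-Reasoning

-- L / 2b + 1 leaves are enough for W times their number to exceed twice the
-- error, and few enough that a factor 2^b for each of them stays below T.
few-leaves : ∀ a b L .{{_ : ℕ.NonZero (2 ℕ.* b)}} → 2 ℕ.* (a ℕ.+ b) ℕ.< L →
             a ℕ.+ b ℕ.* suc (L ℕ./ (2 ℕ.* b)) ℕ.< L
few-leaves a b L h = ℕₚ.*-cancelˡ-< 2 _ _ (begin-strict
  2 ℕ.* (a ℕ.+ b ℕ.* suc q)              ≡⟨ regroup a b q ⟩
  2 ℕ.* (a ℕ.+ b) ℕ.+ q ℕ.* (2 ℕ.* b)    <⟨ ℕₚ.+-mono-<-≤ h (m/n*n≤m L (2 ℕ.* b)) ⟩
  L ℕ.+ L                                ≡⟨ cong (L ℕ.+_) (sym (ℕₚ.+-identityʳ L)) ⟩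
  2 ℕ.* L                                ∎)
  where
  open ℕₚ.≤-Reasoning
  q : ℕ
  q = L ℕ./ (2 ℕ.* b)
  regroup : ∀ a b q → 2 ℕ.* (a ℕ.+ b ℕ.* suc q) ≡ 2 ℕ.* (a ℕ.+ b) ℕ.+ q ℕ.* (2 ℕ.* b)
  regroup = solve 3 (λ a b q → con 2 :* (a :+ b :* (con 1 :+ q)) := con 2 :* (a :+ b) :+ q :* (con 2 :* b)) refl
    where open ℕ-Solver

module _ (n : ℕ) where
  private
    c : ℚ
    c = + 1 ℚ./ suc n

  1/suc-*-≤ : ∀ {x y} → x ℕ.+ x ≤ suc n ℕ.* y → c ℚ.* ι x ℚ.+ c ℚ.* ι x ℚ.≤ ι y
  1/suc-*-≤ {x} {y} h = begin
    c ℚ.* ι x ℚ.+ c ℚ.* ι x      ≡⟨ sym (ℚₚ.*-distribˡ-+ c (ι x) (ι x)) ⟩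
    c ℚ.* (ι x ℚ.+ ι x)          ≡⟨ cong (c ℚ.*_) (sym (ι-+ x x)) ⟩
    c ℚ.* ι (x ℕ.+ x)            ≤⟨ ℚₚ.*-monoˡ-≤-nonNeg c {{ℚ.nonNegative (0≤1/suc n)}} (ι-mono h) ⟩
    c ℚ.* ι (suc n ℕ.* y)        ≡⟨ cong (c ℚ.*_) (ι-* (suc n) y) ⟩
    c ℚ.* (ι (suc n) ℚ.* ι y)    ≡⟨ sym (ℚₚ.*-assoc c (ι (suc n)) (ι y)) ⟩
    c ℚ.* ι (suc n) ℚ.* ι y      ≡⟨ cong (ℚ._* ι y) (1/suc n) ⟩
    1ℚ ℚ.* ι y                   ≡⟨ ℚₚ.*-identityˡ (ι y) ⟩
    ι y                          ∎
    where open ℚₚ.≤-Reasoning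

<ℝ⇒2*≰ : ∀ {α x} q → α <ℝ x → x +ℝ x ≤ℝ fromℚ q → ¬ (fromℚ q ≤ℝ α +ℝ α)
<ℝ⇒2*≰ {α} {x} q (δ , 0<δ , α<x) 2x≤q q≤2α =
  -- With `δ` the gap in `α <ℝ x`, doubling gains `2δ`, while the two tolerances of `δ/2` lose only
  -- `δ`.
  let n , (l , u) , v = eventually-witness (eventually-zip (λ _ → _,_)
                          (eventually-zip (λ _ → _,_) α<x (eventually≤ 2x≤q (½* δ) (0<½* 0<δ)))
                          (eventually≤ q≤2α (½* δ) (0<½* 0<δ)))
  in clash {seq α n} {seq x n} l u v
  where
  open ℚₚ.≤-Reasoning
  clash : ∀ {a x} → a ℚ.+ δ ℚ.≤ x → x ℚ.+ x ℚ.≤ q ℚ.+ ½* δ → q ℚ.≤ (a ℚ.+ a) ℚ.+ ½* δ → ⊥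
  clash {a} {x} l u v = ℚₚ.<-irrefl refl (begin-strict
    (a ℚ.+ a) ℚ.+ δ                  ≡⟨ sym (ℚₚ.+-identityʳ _) ⟩
    (a ℚ.+ a) ℚ.+ δ ℚ.+ 0ℚ           <⟨ ℚₚ.+-monoʳ-< ((a ℚ.+ a) ℚ.+ δ) 0<δ ⟩
    (a ℚ.+ a) ℚ.+ δ ℚ.+ δ            ≡⟨ interchange a δ ⟩
    (a ℚ.+ δ) ℚ.+ (a ℚ.+ δ)          ≤⟨ ℚₚ.+-mono-≤ l l ⟩
    x ℚ.+ x                          ≤⟨ u ⟩
    q ℚ.+ ½* δ                       ≤⟨ ℚₚ.+-monoˡ-≤ (½* δ) v ⟩
    (a ℚ.+ a) ℚ.+ ½* δ ℚ.+ ½* δ      ≡⟨ ℚₚ.+-assoc (a ℚ.+ a) (½* δ) (½* δ) ⟩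
    (a ℚ.+ a) ℚ.+ (½* δ ℚ.+ ½* δ)    ≡⟨ cong ((a ℚ.+ a) ℚ.+_) (½+½ δ) ⟩
    (a ℚ.+ a) ℚ.+ δ                  ∎)
    where
    interchange : ∀ a δ → (a ℚ.+ a) ℚ.+ δ ℚ.+ δ ≡ (a ℚ.+ δ) ℚ.+ (a ℚ.+ δ)
    interchange = solve 2 (λ a δ → (a :+ a) :+ δ :+ δ := (a :+ δ) :+ (a :+ δ)) refl
      where open +-*-Solver

module _ (B M : ℕ) where

  private
    -- `b` is positive, which makes division by `2b` legitimate. `n` is chosen so that `suc n`
    -- computes to `4 * b`, the form `1/suc-*-≤` expects.
    b n : ℕ
    b = suc B
    n = B ℕ.+ 3 ℕ.* b

  -- With `k = L / 2b`, the star of `suc k` leaves weighs at least `W * L / 2b`. The remaining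
  -- factor 2 accounts for disjointness requiring twice the error to be below that weight.
  slope : ℚ
  slope = + 1 ℚ./ (4 ℕ.* b)

  -- Makes the logarithm of `T` exceed `2(M + b)`, the hypothesis of `few-leaves`; the `suc` gives
  -- strictness.
  threshold : ℕ
  threshold = 2 ℕ.^ suc (2 ℕ.* (M ℕ.+ b))

  0<slope : 0ℝ <ℝ fromℚ slope
  0<slope = slope , ℚₚ.positive⁻¹ slope {{ℚₚ.normalize-pos 1 (4 ℕ.* b)}} ,
    0 , λ _ _ → ℚₚ.≤-reflexive (ℚₚ.+-identityˡ slope)

  module _ {ε₀ p : ℝ}
           (exp≤B : ∀ ε → 0ℝ <ℝ ε → ε ≤ℝ ε₀ → Eventually (λ n → ℚ.∣ seq (exp ε) n ∣ ℚ.≤ ι B))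
           (1≤Mp : 1ℝ ≤ℝ fromℕ M *ℝ p) where

    -- If the error were below the bound, the accurate sets would be disjoint and `T` at most
    -- `M * B ^ suc k`. Taking logarithms gives `L ≤ M + b * suc k`, which `few-leaves` refutes.
    log-lower-bound : ∀ (T W : ℕ) → threshold ≤ T → 1 ≤ W →
      ∀ (ε : ℝ) → 0ℝ <ℝ ε → ε ≤ℝ ε₀ →
      ∀ (A : Algorithm W T) → NodePrivate ε A →
      ∀ (α : ℝ) → HasAdditiveError A p α →
      fromℚ slope *ℝ (fromℕ W *ℝ fromℕ ⌊log₂ T ⌋) ≤ℝ α
    log-lower-bound T W T₀≤T 1≤W ε 0<ε ε≤ε₀ A private-A α acc = ≮ℝ⇒≥ℝ {x} {α} λ α<x →
      ℕₚ.<⇒≱ (few-leaves M b L L-large)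
        -- Crude exponents suffice: `M ≤ 2 ^ M` and `B ≤ 2 ^ b` only affect the constants.
        (log≤⇒≤ {a = M} {b} (suc k) (n≤2^n M) (ℕₚ.≤-trans (ℕₚ.n≤1+n B) (n≤2^n b))
          (LowerBound.length-bound 1≤W A {ε} {α} private-A k {p} {M} {B} acc 1≤Mp (exp≤B ε 0<ε ε≤ε₀)
            (<ℝ⇒2*≰ {α} {x} (ι (suc k ℕ.* W)) α<x (pointwise≤⇒≤ℝ {x +ℝ x} {fromℕ (suc k ℕ.* W)} (always λ _ → 2x≤kW)))))
      where
      L k : ℕ
      L = ⌊log₂ T ⌋
      k = L ℕ./ (2 ℕ.* b)
      x : ℝ
      x = fromℚ slope *ℝ (fromℕ W *ℝ fromℕ L)
      L-large : 2 ℕ.* (M ℕ.+ b) ℕ.< L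
      L-large = subst (_≤ L) (⌊log₂[2^n]⌋≡n (suc (2 ℕ.* (M ℕ.+ b)))) (⌊log₂⌋-mono-≤ T₀≤T)
      2WL≤4bkW : W ℕ.* L ℕ.+ W ℕ.* L ≤ (4 ℕ.* b) ℕ.* (suc k ℕ.* W)
      2WL≤4bkW = begin
        W ℕ.* L ℕ.+ W ℕ.* L                                         ≤⟨ ℕₚ.+-mono-≤ WL≤ WL≤ ⟩
        W ℕ.* (suc k ℕ.* (2 ℕ.* b)) ℕ.+ W ℕ.* (suc k ℕ.* (2 ℕ.* b)) ≡⟨ regroup W (suc k) b ⟩
        (4 ℕ.* b) ℕ.* (suc k ℕ.* W)                                 ∎
        where
        open ℕₚ.≤-Reasoning
        WL≤ : W ℕ.* L ≤ W ℕ.* (suc k ℕ.* (2 ℕ.* b))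
        WL≤ = ℕₚ.*-monoʳ-≤ W (m≤[1+m/n]*n L (2 ℕ.* b))
        regroup : ∀ W k b → W ℕ.* (k ℕ.* (2 ℕ.* b)) ℕ.+ W ℕ.* (k ℕ.* (2 ℕ.* b)) ≡ (4 ℕ.* b) ℕ.* (k ℕ.* W)
        regroup = solve 3 (λ W k b → W :* (k :* (con 2 :* b)) :+ W :* (k :* (con 2 :* b)) := (con 4 :* b) :* (k :* W)) refl
          where open ℕ-Solver
      2x≤kW : slope ℚ.* (ι W ℚ.* ι L) ℚ.+ slope ℚ.* (ι W ℚ.* ι L) ℚ.≤ ι (suc k ℕ.* W)
      2x≤kW = subst (λ z → slope ℚ.* z ℚ.+ slope ℚ.* z ℚ.≤ ι (suc k ℕ.* W)) (ι-* W L) (1/suc-*-≤ n 2WL≤4bkW)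

theorem30 : ∀ (ε₀ p : ℝ) → 0ℝ <ℝ ε₀ → 0ℝ <ℝ p →
    ∃[ c ] 0ℝ <ℝ c × ∃[ T₀ ]
    (∀ (T W : ℕ) → T₀ ≤ T → 1 ≤ W →
    ∀ (ε : ℝ) → 0ℝ <ℝ ε → ε ≤ℝ ε₀ →
    ∀ (A : Algorithm W T) → NodePrivate ε A →
    ∀ (α : ℝ) → HasAdditiveError A p α →
    c *ℝ (fromℕ W *ℝ fromℕ ⌊log₂ T ⌋) ≤ℝ α)
theorem30 ε₀ p _ 0<p =
  -- `B` depends on `ε₀` alone and `M` on `p` alone, so slope and threshold are fixed before `T`,
  -- `W`, `ε` and the algorithm. The choice `ε₀ = 1` covers `ε = 1`.
  let B , exp≤B = exp-locally-bounded ε₀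
      M , 1≤Mp  = archimedean-inverse {p} 0<p
  in fromℚ (slope B M) , 0<slope B M , threshold B M , log-lower-bound B M {ε₀} {p} exp≤B 1≤Mp
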